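{- For every integer $k\geq 1$ and every integer $n\geq 0$, in $\mathbb{Q}(t)$, $$\sum_{i=k2^{n}}^{k2^{n+1}}\frac{1}{B_i(t)B_{i+1}(t)}=\frac{(2-t)\,S_k(t)}{t^{\,n+\lfloor\log_2 k\rfloor+1}B_k(t)}+\frac{1}{t^{\,n+1}B_k(t)}\left(\frac{1}{B_{k2^{n+1}+1}(t)}+1\right),$$ where the sum runs over all integers $i$ with $k2^n\leq i\leq k2^{n+1}$.
   Context: The Stern polynomials $B_n(t)\in\mathbb{Z}[t]$ are defined by $B_0(t)=0$, $B_1(t)=1$, and for $n\geq 1$: $B_{2n}(t)=tB_n(t)$, $B_{2n+1}(t)=B_n(t)+B_{n+1}(t)$. The polynomials $S_n(t)$, $n\ge1$, are defined by $S_1(t)=S_2(t)=0$ and, for $k\geq 1$, $S_{2k}(t)=tS_k(t)$, $S_{2k+1}(t)=S_k(t)+S_{k+1}(t)+t^{\lfloor\log_2 k\rfloor}$. -}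

module Defs where

open import Algebra.Bundles using (CommutativeRing)
open import Data.Empty using (⊥-elim)
open import Data.Integer.Base as ℤ using (ℤ; +_; 0ℤ)
open import Data.Integer.GCD using (gcd)
import Data.Integer.Properties as ℤ
open import Data.Integer.Tactic.RingSolver using (solve-∀)
open import Data.List.Base using (List; []; _∷_; map)
open import Data.Nat.Base as ℕ using (ℕ; zero; suc; _∸_; NonZero; _<_; s≤s; z≤n)
open import Data.Nat.Induction using (Acc; acc; <-wellFounded)
open import Data.Nat.Logarithm using (⌊log₂_⌋)
import Data.Nat.Properties as ℕ
open import Data.Rational.Base as ℚ using (ℚ; 0ℚ)
import Data.Rational.Properties as ℚ
open import Data.Sum.Base using (inj₁; inj₂)
open import Relation.Binary.PropositionalEquality using (_≡_; refl; sym; trans; cong; cong₂; subst; module ≡-Reasoning)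
open import Relation.Nullary using (¬_; Dec; yes; no)

module Polynomial {c ℓ} (R : CommutativeRing c ℓ) where
  open CommutativeRing R using (Carrier; _≈_; _+_; _*_; -_; 0#; 1#)
  private module R = CommutativeRing R

  infix  4 _≈ₚ_
  infixl 6 _+ₚ_ _-ₚ_
  infixl 7 _*ₚ_ _·_
  infixr 8 _^ₚ_

  -- Coefficient lists, constant term first.  Trailing zeros are allowed, so
  -- equality of polynomials is _≈ₚ_.
  Poly : Set c
  Poly = List Carrier

  coeff : Poly → ℕ → Carrier
  coeff []      _       = 0#
  coeff (a ∷ p) zero    = a
  coeff (a ∷ p) (suc i) = coeff p i

  record _≈ₚ_ (p q : Poly) : Set ℓ where
    constructor coeffs
    field coeff-≈ : ∀ i → coeff p i ≈ coeff q i
  open _≈ₚ_ public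

  0ₚ 1ₚ t : Poly
  0ₚ = []
  1ₚ = 1# ∷ []
  t  = 0# ∷ 1# ∷ []

  const : Carrier → Poly
  const a = a ∷ []

  _+ₚ_ : Poly → Poly → Poly
  []      +ₚ q       = q
  (a ∷ p) +ₚ []      = a ∷ p
  (a ∷ p) +ₚ (b ∷ q) = (a + b) ∷ (p +ₚ q)

  _-ₚ_ : Poly → Poly → Poly
  p -ₚ q = p +ₚ map (-_) q

  _·_ : Carrier → Poly → Poly
  a · p = map (a *_) p

  _*ₚ_ : Poly → Poly → Poly
  []      *ₚ q = []
  (a ∷ p) *ₚ q = a · q +ₚ (0# ∷ (p *ₚ q))

  _^ₚ_ : Poly → ℕ → Poly
  p ^ₚ zero  = 1ₚ
  p ^ₚ suc n = p *ₚ p ^ₚ n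

  _≉0 : Poly → Set ℓ
  p ≉0 = ¬ (p ≈ₚ 0ₚ)

  coeff-+ₚ : ∀ p q i → coeff (p +ₚ q) i ≈ coeff p i + coeff q i
  coeff-+ₚ []      q       i       = R.sym (R.+-identityˡ _)
  coeff-+ₚ (a ∷ p) []      i       = R.sym (R.+-identityʳ _)
  coeff-+ₚ (a ∷ p) (b ∷ q) zero    = R.refl
  coeff-+ₚ (a ∷ p) (b ∷ q) (suc i) = coeff-+ₚ p q i

  coeff-· : ∀ a p i → coeff (a · p) i ≈ a * coeff p i
  coeff-· a []      i       = R.sym (R.zeroʳ a)
  coeff-· a (b ∷ p) zero    = R.refl
  coeff-· a (b ∷ p) (suc i) = coeff-· a p i

  coeff-*ₚ-∷ : ∀ a p q i →
               coeff ((a ∷ p) *ₚ q) i ≈ a * coeff q i + coeff (0# ∷ (p *ₚ q)) i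
  coeff-*ₚ-∷ a p q i =
    R.trans (coeff-+ₚ (a · q) _ i) (R.+-congʳ (coeff-· a q i))

  module NoZeroDivisors
    (≈0?    : ∀ a → Dec (a ≈ 0#))
    (1≉0    : ¬ (1# ≈ 0#))
    (cancel : ∀ a b → ¬ (a ≈ 0#) → a * b ≈ 0# → b ≈ 0#)
    where

    private
      zero-+ : ∀ {x y z} → x ≈ 0# → y ≈ z → x + y ≈ z
      zero-+ x≈0 y≈z = R.trans (R.+-cong x≈0 y≈z) (R.+-identityˡ _)

      zero-+⁻ : ∀ {x y z} → x ≈ 0# → x + y ≈ z → y ≈ z
      zero-+⁻ x≈0 e =
        R.trans (R.sym (R.trans (R.+-congʳ x≈0) (R.+-identityˡ _))) e

      zero-* : ∀ {x} y → x ≈ 0# → x * y ≈ 0#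
      zero-* y x≈0 = R.trans (R.*-congʳ x≈0) (R.zeroˡ y)

      *-zero : ∀ x {y} → y ≈ 0# → x * y ≈ 0#
      *-zero x y≈0 = R.trans (R.*-congˡ y≈0) (R.zeroʳ x)

      ∷-≈0 : ∀ {a p} → a ≈ 0# → p ≈ₚ 0ₚ → (a ∷ p) ≈ₚ 0ₚ
      ∷-≈0 a≈0 p≈0 = coeffs λ { zero → a≈0 ; (suc i) → coeff-≈ p≈0 i }

      low : ∀ p {b} q → b ≈ 0# → coeff (p *ₚ (b ∷ q)) 0 ≈ 0#
      low []      q b≈0 = R.refl
      low (c ∷ p) q b≈0 =
        R.trans (coeff-*ₚ-∷ c p (_ ∷ q) 0) (zero-+ (*-zero c b≈0) R.refl)

      shift : ∀ p {b} q → b ≈ 0# →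
              ∀ i → coeff (p *ₚ (b ∷ q)) (suc i) ≈ coeff (p *ₚ q) i
      shift []      q b≈0 i       = R.refl
      shift (c ∷ p) q b≈0 zero    =
        R.trans (coeff-*ₚ-∷ c p (_ ∷ q) 1)
          (R.trans (R.+-congˡ (low p q b≈0)) (R.sym (coeff-*ₚ-∷ c p q 0)))
      shift (c ∷ p) q b≈0 (suc i) =
        R.trans (coeff-*ₚ-∷ c p (_ ∷ q) (suc (suc i)))
          (R.trans (R.+-congˡ (shift p q b≈0 i)) (R.sym (coeff-*ₚ-∷ c p q (suc i))))

      cancelₚ : ∀ a p q → ¬ (a ≈ 0#) → ((a ∷ p) *ₚ q) ≈ₚ 0ₚ → q ≈ₚ 0ₚ
      cancelₚ a p []      a≉0 e = coeffs λ _ → R.refl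
      cancelₚ a p (b ∷ q) a≉0 e = ∷-≈0 b≈0 (cancelₚ a p q a≉0 (coeffs λ i →
        R.trans (R.sym (shift (a ∷ p) q b≈0 i)) (coeff-≈ e (suc i))))
        where
        b≈0 : b ≈ 0#
        b≈0 = cancel a b a≉0 (R.trans (R.sym (R.+-identityʳ _)) (coeff-≈ e 0))

    *ₚ-≉0 : ∀ {p q} → p ≉0 → q ≉0 → (p *ₚ q) ≉0
    *ₚ-≉0 {[]}    {q} p≉0 q≉0 e = p≉0 e
    *ₚ-≉0 {a ∷ p} {q} p≉0 q≉0 e with ≈0? a
    ... | no  a≉0 = q≉0 (cancelₚ a p q a≉0 e)
    ... | yes a≈0 = *ₚ-≉0 {p} {q} (λ p≈0 → p≉0 (∷-≈0 a≈0 p≈0)) q≉0 (coeffs λ i →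
      zero-+⁻ (zero-* (coeff q (suc i)) a≈0)
        (R.trans (R.sym (coeff-*ₚ-∷ a p q (suc i))) (coeff-≈ e (suc i))))

    1ₚ-≉0 : 1ₚ ≉0
    1ₚ-≉0 e = 1≉0 (coeff-≈ e 0)

    t-≉0 : t ≉0
    t-≉0 e = 1≉0 (coeff-≈ e 1)

    ^ₚ-≉0 : ∀ {p} → p ≉0 → ∀ n → (p ^ₚ n) ≉0
    ^ₚ-≉0         p≉0 zero    = 1ₚ-≉0
    ^ₚ-≉0 {p = p} p≉0 (suc n) = *ₚ-≉0 {p} {p ^ₚ n} p≉0 (^ₚ-≉0 {p} p≉0 n)

open Polynomial ℤ.+-*-commutativeRing public
  using (_≈ₚ_; coeffs; coeff-≈; coeff; 0ₚ; 1ₚ; t; const; _+ₚ_; _-ₚ_; _·_; _*ₚ_; _^ₚ_; _≉0)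
  renaming (Poly to ℤ[t])

module ℚ[t] = Polynomial ℚ.+-*-commutativeRing

ℚ[t] : Set
ℚ[t] = ℚ[t].Poly

ι : ℤ[t] → ℚ[t]
ι = map (λ a → a ℚ./ 1)

private
  ℤ-cancel : ∀ a b → ¬ (a ≡ 0ℤ) → a ℤ.* b ≡ 0ℤ → b ≡ 0ℤ
  ℤ-cancel a b a≢0 ab≡0 with ℤ.i*j≡0⇒i≡0∨j≡0 a ab≡0
  ... | inj₁ a≡0 = ⊥-elim (a≢0 a≡0)
  ... | inj₂ b≡0 = b≡0

  ℚ-cancel : ∀ a b → ¬ (a ≡ 0ℚ) → a ℚ.* b ≡ 0ℚ → b ≡ 0ℚ
  ℚ-cancel a b a≢0 ab≡0 = begin
    b                      ≡⟨ ℚ.*-identityˡ b ⟨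
    ℚ.1ℚ ℚ.* b             ≡⟨ cong (ℚ._* b) (ℚ.*-inverseˡ a) ⟨
    ℚ.1/ a ℚ.* a ℚ.* b     ≡⟨ ℚ.*-assoc (ℚ.1/ a) a b ⟩
    ℚ.1/ a ℚ.* (a ℚ.* b)   ≡⟨ cong (ℚ.1/ a ℚ.*_) ab≡0 ⟩
    ℚ.1/ a ℚ.* 0ℚ          ≡⟨ ℚ.*-zeroʳ (ℚ.1/ a) ⟩
    0ℚ                     ∎
    where
    open ≡-Reasoning
    instance
      a≠0 : ℚ.NonZero a
      a≠0 = ℚ.≢-nonZero a≢0

  /1-injective₀ : ∀ a → a ℚ./ 1 ≡ 0ℚ → a ≡ 0ℤ
  /1-injective₀ a e = trans (sym (ℚ.↥-/ a 1)) (cong (λ x → ℚ.↥ x ℤ.* gcd a (+ 1)) e)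

  coeff-ι : ∀ p i → ℚ[t].coeff (ι p) i ≡ coeff p i ℚ./ 1
  coeff-ι []      i       = refl
  coeff-ι (a ∷ p) zero    = refl
  coeff-ι (a ∷ p) (suc i) = coeff-ι p i

open Polynomial.NoZeroDivisors ℤ.+-*-commutativeRing (ℤ._≟ 0ℤ) (λ ()) ℤ-cancel public
  using (*ₚ-≉0; ^ₚ-≉0; t-≉0; 1ₚ-≉0)

module ℚ[t]-domain = ℚ[t].NoZeroDivisors (ℚ._≟ 0ℚ) (λ ()) ℚ-cancel

ι-≉0 : ∀ {p} → p ≉0 → ι p ℚ[t].≉0
ι-≉0 {p} p≉0 e = p≉0 (coeffs λ i →
  /1-injective₀ (coeff p i) (trans (sym (coeff-ι p i)) (ℚ[t].coeff-≈ e i)))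

infix 4 _≃_
infixl 6 _+ᶠ_
infixl 7 _*ᶠ_

-- The field ℚ(t) of fractions of ℚ[t]; its equality is _≃_.
record ℚ⟨t⟩ : Set where
  constructor frac
  field
    num   : ℚ[t]
    den   : ℚ[t]
    den≉0 : den ℚ[t].≉0
open ℚ⟨t⟩ public

record _≃_ (x y : ℚ⟨t⟩) : Set where
  constructor cross
  field cross-≈ : (num x ℚ[t].*ₚ den y) ℚ[t].≈ₚ (num y ℚ[t].*ₚ den x)
open _≃_ public

-- p / q ⟨ q≉0 ⟩ is the element p/q of ℚ(t), for p, q in ℤ[t] with q ≠ 0.
_/_⟨_⟩ : (p q : ℤ[t]) → q ≉0 → ℚ⟨t⟩
p / q ⟨ q≉0 ⟩ = frac (ι p) (ι q) (ι-≉0 q≉0)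

0ᶠ 1ᶠ : ℚ⟨t⟩
0ᶠ = 0ₚ / 1ₚ ⟨ 1ₚ-≉0 ⟩
1ᶠ = 1ₚ / 1ₚ ⟨ 1ₚ-≉0 ⟩

_+ᶠ_ : ℚ⟨t⟩ → ℚ⟨t⟩ → ℚ⟨t⟩
frac a b b≉0 +ᶠ frac c d d≉0 =
  frac ((a ℚ[t].*ₚ d) ℚ[t].+ₚ (c ℚ[t].*ₚ b)) (b ℚ[t].*ₚ d)
       (ℚ[t]-domain.*ₚ-≉0 {b} {d} b≉0 d≉0)

_*ᶠ_ : ℚ⟨t⟩ → ℚ⟨t⟩ → ℚ⟨t⟩
frac a b b≉0 *ᶠ frac c d d≉0 =
  frac (a ℚ[t].*ₚ c) (b ℚ[t].*ₚ d) (ℚ[t]-domain.*ₚ-≉0 {b} {d} b≉0 d≉0)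

-- f a + f (a + 1) + ⋯  with m terms.
sumFrom : (a m : ℕ) .{{_ : NonZero a}} → ((i : ℕ) .{{_ : NonZero i}} → ℚ⟨t⟩) → ℚ⟨t⟩
sumFrom a zero    f = 0ᶠ
sumFrom a (suc m) f = f a +ᶠ sumFrom (suc a) m f

-- The sum of f i over all i with a ≤ i ≤ b.
∑[_⋯_] : (a b : ℕ) .{{_ : NonZero a}} → ((i : ℕ) .{{_ : NonZero i}} → ℚ⟨t⟩) → ℚ⟨t⟩
∑[ a ⋯ b ] f = sumFrom a (suc b ∸ a) f

k*2^n≢0 : ∀ k n .{{_ : NonZero k}} → NonZero (k ℕ.* 2 ℕ.^ n)
k*2^n≢0 k n {{k≢0}} = ℕ.m*n≢0 k (2 ℕ.^ n) {{k≢0}} {{ℕ.m^n≢0 2 n}}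

data Halving : ℕ → Set where
  even : ∀ m → Halving (2 ℕ.* m)
  odd  : ∀ m → Halving (suc (2 ℕ.* m))

halve : ∀ n → Halving n
halve zero = even 0
halve (suc n) with halve n
... | even m = odd m
... | odd  m = subst Halving (cong suc (ℕ.+-suc m (m ℕ.+ 0))) (even (suc m))

module BinaryRecursion {A : Set} (f₀ f₁ : A) (e : A → A) (o : ℕ → A → A → A) where

  -- f is the unique function with f 0 = f₀, f 1 = f₁ and, for m ≥ 1,
  -- f (2m) = e (f m) and f (2m+1) = o m (f m) (f (m+1)).
  rec         : ∀ n → Acc _<_ n → A
  rec-halving : ∀ {n} → Halving n → Acc _<_ n → A

  rec n a = rec-halving (halve n) a

  rec-halving (even zero)      _        = f₀
  rec-halving (even m@(suc _)) (acc rs) = e (rec m (rs (ℕ.m<m+n m (s≤s z≤n))))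
  rec-halving (odd zero)       _        = f₁
  rec-halving (odd m@(suc _))  (acc rs) =
    o m (rec m (rs (s≤s (ℕ.m≤m+n m _)))) (rec (suc m) (rs (s≤s (ℕ.m<m+n m (s≤s z≤n)))))

  f : ℕ → A
  f n = rec n (<-wellFounded n)

  private
    even-injective : ∀ {m n} → 2 ℕ.* m ≡ 2 ℕ.* n → m ≡ n
    even-injective {m} {n} = ℕ.*-cancelˡ-≡ m n 2

    even≢odd : ∀ m n → ¬ (2 ℕ.* m ≡ suc (2 ℕ.* n))
    even≢odd m n eq = ℕ.even≢odd m n eq

    rec-halving-irr : ∀ {n n′} → n ≡ n′ → (h : Halving n) (h′ : Halving n′)
                      (a : Acc _<_ n) (a′ : Acc _<_ n′) → rec-halving h a ≡ rec-halving h′ a′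
    rec-halving-irr eq (even m) (odd m′) a a′ = ⊥-elim (even≢odd m m′ eq)
    rec-halving-irr eq (odd m) (even m′) a a′ = ⊥-elim (even≢odd m′ m (sym eq))
    rec-halving-irr eq (even m) (even m′) a a′ with even-injective {m} {m′} eq
    rec-halving-irr eq (even zero) (even .zero) a a′ | refl = refl
    rec-halving-irr eq (even m@(suc _)) (even .m) (acc rs) (acc rs′) | refl =
      cong e (rec-halving-irr refl (halve m) (halve m) _ _)
    rec-halving-irr eq (odd m) (odd m′) a a′ with even-injective {m} {m′} (ℕ.suc-injective eq)
    rec-halving-irr eq (odd zero) (odd .zero) a a′ | refl = refl
    rec-halving-irr eq (odd m@(suc _)) (odd .m) (acc rs) (acc rs′) | refl =
      cong₂ (o m) (rec-halving-irr refl (halve m) (halve m) _ _)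
                  (rec-halving-irr refl (halve (suc m)) (halve (suc m)) _ _)

  f-even : ∀ m .{{_ : NonZero m}} → f (2 ℕ.* m) ≡ e (f m)
  f-even m@(suc _) =
    trans (rec-halving-irr refl (halve (2 ℕ.* m)) (even m) _ (acc λ {k} _ → <-wellFounded k))
          (cong e (rec-halving-irr refl (halve m) (halve m) _ _))

  f-odd : ∀ m .{{_ : NonZero m}} → f (suc (2 ℕ.* m)) ≡ o m (f m) (f (suc m))
  f-odd m@(suc _) =
    trans (rec-halving-irr refl (halve (suc (2 ℕ.* m))) (odd m) _ (acc λ {k} _ → <-wellFounded k))
          (cong₂ (o m) (rec-halving-irr refl (halve m) (halve m) _ _)
                       (rec-halving-irr refl (halve (suc m)) (halve (suc m)) _ _))

module B-rec = BinaryRecursion 0ₚ 1ₚ (t *ₚ_) (λ _ p q → p +ₚ q)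

-- S n is meant for n ≥ 1; S 0 is a junk value.  S 2 = t S 1 = 0 is an
-- instance of the even case.
module S-rec = BinaryRecursion 0ₚ 0ₚ (t *ₚ_) (λ k p q → p +ₚ q +ₚ t ^ₚ ⌊log₂ k ⌋)

B S : ℕ → ℤ[t]
B = B-rec.f
S = S-rec.f

B-0 : B 0 ≡ 0ₚ
B-0 = refl

B-1 : B 1 ≡ 1ₚ
B-1 = refl

B-even : ∀ n .{{_ : NonZero n}} → B (2 ℕ.* n) ≡ t *ₚ B n
B-even = B-rec.f-even

B-odd : ∀ n .{{_ : NonZero n}} → B (suc (2 ℕ.* n)) ≡ B n +ₚ B (suc n)
B-odd = B-rec.f-odd

S-1 : S 1 ≡ 0ₚ
S-1 = refl

S-2 : S 2 ≈ₚ 0ₚ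
S-2 = coeffs λ { 0 → refl ; 1 → refl ; (suc (suc i)) → refl }

S-even : ∀ k .{{_ : NonZero k}} → S (2 ℕ.* k) ≡ t *ₚ S k
S-even = S-rec.f-even

S-odd : ∀ k .{{_ : NonZero k}} → S (suc (2 ℕ.* k)) ≡ S k +ₚ S (suc k) +ₚ t ^ₚ ⌊log₂ k ⌋
S-odd = S-rec.f-odd

private
  eval₂ : ℤ[t] → ℤ
  eval₂ []      = 0ℤ
  eval₂ (a ∷ p) = a ℤ.+ + 2 ℤ.* eval₂ p

  eval₂-+ : ∀ p q → eval₂ (p +ₚ q) ≡ eval₂ p ℤ.+ eval₂ q
  eval₂-+ []      q       = sym (ℤ.+-identityˡ _)
  eval₂-+ (a ∷ p) []      = sym (ℤ.+-identityʳ _)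
  eval₂-+ (a ∷ p) (b ∷ q) =
    trans (cong (λ x → a ℤ.+ b ℤ.+ + 2 ℤ.* x) (eval₂-+ p q)) (lemma a b (eval₂ p) (eval₂ q))
    where
    lemma : ∀ a b x y → a ℤ.+ b ℤ.+ + 2 ℤ.* (x ℤ.+ y) ≡ (a ℤ.+ + 2 ℤ.* x) ℤ.+ (b ℤ.+ + 2 ℤ.* y)
    lemma = solve-∀

  eval₂-· : ∀ a p → eval₂ (a · p) ≡ a ℤ.* eval₂ p
  eval₂-· a []      = sym (ℤ.*-zeroʳ a)
  eval₂-· a (b ∷ p) =
    trans (cong (λ x → a ℤ.* b ℤ.+ + 2 ℤ.* x) (eval₂-· a p)) (lemma a b (eval₂ p))
    where
    lemma : ∀ a b x → a ℤ.* b ℤ.+ + 2 ℤ.* (a ℤ.* x) ≡ a ℤ.* (b ℤ.+ + 2 ℤ.* x)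
    lemma = solve-∀

  eval₂-* : ∀ p q → eval₂ (p *ₚ q) ≡ eval₂ p ℤ.* eval₂ q
  eval₂-* []      q = sym (ℤ.*-zeroˡ (eval₂ q))
  eval₂-* (a ∷ p) q = begin
    eval₂ (a · q +ₚ (0ℤ ∷ (p *ₚ q)))
      ≡⟨ eval₂-+ (a · q) _ ⟩
    eval₂ (a · q) ℤ.+ (0ℤ ℤ.+ + 2 ℤ.* eval₂ (p *ₚ q))
      ≡⟨ cong₂ (λ x y → x ℤ.+ (0ℤ ℤ.+ + 2 ℤ.* y)) (eval₂-· a q) (eval₂-* p q) ⟩
    a ℤ.* eval₂ q ℤ.+ (0ℤ ℤ.+ + 2 ℤ.* (eval₂ p ℤ.* eval₂ q))
      ≡⟨ lemma a (eval₂ p) (eval₂ q) ⟩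
    (a ℤ.+ + 2 ℤ.* eval₂ p) ℤ.* eval₂ q ∎
    where
    open ≡-Reasoning
    lemma : ∀ a x y → a ℤ.* y ℤ.+ (0ℤ ℤ.+ + 2 ℤ.* (x ℤ.* y)) ≡ (a ℤ.+ + 2 ℤ.* x) ℤ.* y
    lemma = solve-∀

  eval₂-≈0 : ∀ p → p ≈ₚ 0ₚ → eval₂ p ≡ 0ℤ
  eval₂-≈0 []      e = refl
  eval₂-≈0 (a ∷ p) e =
    cong₂ (λ x y → x ℤ.+ + 2 ℤ.* y) (coeff-≈ e 0) (eval₂-≈0 p (coeffs λ i → coeff-≈ e (suc i)))

  eval₂-rec : ∀ {n} (h : Halving n) (a : Acc _<_ n) → eval₂ (B-rec.rec-halving h a) ≡ + n
  eval₂-rec (even zero)      a        = refl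
  eval₂-rec (even m@(suc _)) (acc rs) =
    trans (eval₂-* t (B-rec.rec m _))
      (trans (cong (+ 2 ℤ.*_) (eval₂-rec (halve m) _)) (sym (ℤ.pos-* 2 m)))
  eval₂-rec (odd zero)       a        = refl
  eval₂-rec (odd m@(suc _))  (acc rs) =
    trans (eval₂-+ (B-rec.rec m _) (B-rec.rec (suc m) _))
      (trans (cong₂ ℤ._+_ (eval₂-rec (halve m) _) (eval₂-rec (halve (suc m)) _))
             (cong +_ (trans (ℕ.+-suc m m) (cong (λ x → suc (m ℕ.+ x)) (sym (ℕ.+-identityʳ m))))))

-- The value of B n at t = 2 is n.
B-≉0 : ∀ n .{{_ : NonZero n}} → B n ≉0
B-≉0 n e = ℕ.≢-nonZero⁻¹ n (ℤ.+-injective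
  (trans (sym (eval₂-rec (halve n) (<-wellFounded n))) (eval₂-≈0 (B n) e)))

{-# OPTIONS --safe #-}
module Submission where

-- Write g i = 1 / (B i · B (i+1)) and T a = ∑ g i over a ≤ i < 2a.  The recursion
-- for B gives g (2i) + g (2i+1) = g i / t, hence T (2a) = T a / t and
-- T (a+1) − T a = (1/t − 1) g a.  From these, U k = B k · T k satisfies
-- U (2k) = U k and U (2k+1) = (U k + U (k+1)) / t, and the recursion for S shows
-- by binary induction that U k = (2 − t) S k / t^(⌊log₂ k⌋ + 1) + 1/t; here
-- ⌊log₂ (k+1)⌋ may replace ⌊log₂ k⌋ because S vanishes at powers of two.
-- The sum in question is T (k 2ⁿ) + g (k 2ⁿ⁺¹) = T k / tⁿ + g (k 2ⁿ⁺¹).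

open import Defs using (module Polynomial; Halving; even; odd; halve; k*2^n≢0)
open import Algebra.Bundles using (CommutativeRing; CommutativeSemiring)
import Algebra.Consequences.Setoid as Consequences
import Algebra.Properties.Group as GroupProperties
import Algebra.Properties.Ring as RingProperties
import Algebra.Properties.Semiring.Exp as Exp
import Algebra.Solver.Ring.NaturalCoefficients.Default as NaturalCoefficients
open import Data.Integer.Base as ℤ using (+_)
import Data.Integer.Properties as ℤ
open import Data.List.Base using ([]; _∷_; map)
open import Data.Nat.Base as ℕ using (ℕ; zero; suc; _<_; s≤s; z≤n; NonZero)
open import Data.Nat.Induction using (<-rec)
open import Data.Nat.Logarithm using (⌊log₂_⌋; ⌊log₂[2*b]⌋≡1+⌊log₂b⌋; ⌊log₂⌊n/2⌋⌋≡⌊log₂n⌋∸1; ⌊log₂⌋-mono-≤)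
import Data.Nat.Properties as ℕ
open import Data.Product.Base using (proj₂)
open import Data.Rational.Base as ℚ using (0ℚ)
import Data.Rational.Properties as ℚ
import Data.Rational.Unnormalised.Base as ℚᵘ
import Data.Rational.Unnormalised.Properties as ℚᵘ
open import Data.Sum.Base as Sum using (_⊎_; inj₁; inj₂)
open import Level using (_⊔_)
open import Relation.Binary.Bundles using (Setoid)
open import Relation.Binary.PropositionalEquality as ≡ using (_≡_; module ≡-Reasoning)
import Relation.Binary.Reasoning.Setoid as SetoidReasoning
open import Relation.Binary.Structures using (IsEquivalence)
open import Relation.Nullary.Decidable using (decidable-stable)

-- The commutative ring structure on coefficient lists.

module PolynomialRing {c ℓ} (R : CommutativeRing c ℓ) where
  open Polynomial R
  private
    module R = CommutativeRing R
  open R using (Carrier; _≈_; 0#; 1#; -_)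

  ≈ₚ-isEquivalence : IsEquivalence _≈ₚ_
  ≈ₚ-isEquivalence = record
    { refl  = coeffs λ _ → R.refl
    ; sym   = λ e → coeffs λ i → R.sym (coeff-≈ e i)
    ; trans = λ e f → coeffs λ i → R.trans (coeff-≈ e i) (coeff-≈ f i)
    }

  polySetoid : Setoid c ℓ
  polySetoid = record { isEquivalence = ≈ₚ-isEquivalence }

  private
    module ≈ₚ = IsEquivalence ≈ₚ-isEquivalence

  ∷-cong : ∀ {a b p q} → a ≈ b → p ≈ₚ q → (a ∷ p) ≈ₚ (b ∷ q)
  ∷-cong a≈b p≈q = coeffs λ { zero → a≈b ; (suc i) → coeff-≈ p≈q i }

  +ₚ-cong : ∀ {p p′ q q′} → p ≈ₚ p′ → q ≈ₚ q′ → (p +ₚ q) ≈ₚ (p′ +ₚ q′)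
  +ₚ-cong {p} {p′} {q} {q′} e f = coeffs λ i → R.trans (coeff-+ₚ p q i)
    (R.trans (R.+-cong (coeff-≈ e i) (coeff-≈ f i)) (R.sym (coeff-+ₚ p′ q′ i)))

  +ₚ-comm : ∀ p q → (p +ₚ q) ≈ₚ (q +ₚ p)
  +ₚ-comm []      []      = ≈ₚ.refl
  +ₚ-comm []      (_ ∷ _) = ≈ₚ.refl
  +ₚ-comm (_ ∷ _) []      = ≈ₚ.refl
  +ₚ-comm (a ∷ p) (b ∷ q) = ∷-cong (R.+-comm a b) (+ₚ-comm p q)

  +ₚ-assoc : ∀ p q r → ((p +ₚ q) +ₚ r) ≈ₚ (p +ₚ (q +ₚ r))
  +ₚ-assoc []      q       r       = ≈ₚ.refl
  +ₚ-assoc (_ ∷ _) []      r       = ≈ₚ.refl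
  +ₚ-assoc (_ ∷ _) (_ ∷ _) []      = ≈ₚ.refl
  +ₚ-assoc (a ∷ p) (b ∷ q) (c ∷ r) = ∷-cong (R.+-assoc a b c) (+ₚ-assoc p q r)

  +ₚ-identityˡ : ∀ p → (0ₚ +ₚ p) ≈ₚ p
  +ₚ-identityˡ p = ≈ₚ.refl

  -ₚ_ : Poly → Poly
  -ₚ p = map (-_) p

  coeff-neg : ∀ p i → coeff (-ₚ p) i ≈ - coeff p i
  coeff-neg []      i       = R.sym (RingProperties.-0#≈0# R.ring)
  coeff-neg (a ∷ p) zero    = R.refl
  coeff-neg (a ∷ p) (suc i) = coeff-neg p i

  -ₚ-cong : ∀ {p q} → p ≈ₚ q → (-ₚ p) ≈ₚ (-ₚ q)
  -ₚ-cong {p} {q} e = coeffs λ i →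
    R.trans (coeff-neg p i) (R.trans (R.-‿cong (coeff-≈ e i)) (R.sym (coeff-neg q i)))

  -ₚ-inverseˡ : ∀ p → (-ₚ p +ₚ p) ≈ₚ 0ₚ
  -ₚ-inverseˡ p = coeffs λ i → R.trans (coeff-+ₚ (-ₚ p) p i)
    (R.trans (R.+-congʳ (coeff-neg p i)) (R.-‿inverseˡ (coeff p i)))

  ·-cong : ∀ {a b p q} → a ≈ b → p ≈ₚ q → (a · p) ≈ₚ (b · q)
  ·-cong {a} {b} {p} {q} a≈b p≈q = coeffs λ i → R.trans (coeff-· a p i)
    (R.trans (R.*-cong a≈b (coeff-≈ p≈q i)) (R.sym (coeff-· b q i)))

  ·-distrib-+ₚ : ∀ a p q → (a · (p +ₚ q)) ≈ₚ (a · p +ₚ a · q)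
  ·-distrib-+ₚ a []      q       = ≈ₚ.refl
  ·-distrib-+ₚ a (_ ∷ _) []      = ≈ₚ.refl
  ·-distrib-+ₚ a (b ∷ p) (c ∷ q) = ∷-cong (R.distribˡ a b c) (·-distrib-+ₚ a p q)

  ·-assoc : ∀ a b p → ((a R.* b) · p) ≈ₚ (a · (b · p))
  ·-assoc a b []      = ≈ₚ.refl
  ·-assoc a b (c ∷ p) = ∷-cong (R.*-assoc a b c) (·-assoc a b p)

  1·-identity : ∀ p → (1# · p) ≈ₚ p
  1·-identity []      = ≈ₚ.refl
  1·-identity (a ∷ p) = ∷-cong (R.*-identityˡ a) (1·-identity p)

  0·-zero : ∀ p → (0# · p) ≈ₚ 0ₚ
  0·-zero p = coeffs λ i → R.trans (coeff-· 0# p i) (R.zeroˡ _)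

  0∷-zero : (0# ∷ []) ≈ₚ 0ₚ
  0∷-zero = coeffs λ { zero → R.refl ; (suc i) → R.refl }

  0∷-+ₚ : ∀ p q → (0# ∷ (p +ₚ q)) ≈ₚ ((0# ∷ p) +ₚ (0# ∷ q))
  0∷-+ₚ p q = ∷-cong (R.sym (R.+-identityˡ 0#)) ≈ₚ.refl

  0∷-· : ∀ a p → (0# ∷ (a · p)) ≈ₚ (a · (0# ∷ p))
  0∷-· a p = ∷-cong (R.sym (R.zeroʳ a)) ≈ₚ.refl

  +ₚ-interchange : ∀ p q r s → ((p +ₚ q) +ₚ (r +ₚ s)) ≈ₚ ((p +ₚ r) +ₚ (q +ₚ s))
  +ₚ-interchange = Consequences.comm∧assoc⇒middleFour polySetoid +ₚ-cong +ₚ-comm +ₚ-assoc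

  open SetoidReasoning polySetoid

  *ₚ-congˡ : ∀ p {q r} → q ≈ₚ r → (p *ₚ q) ≈ₚ (p *ₚ r)
  *ₚ-congˡ []      e = ≈ₚ.refl
  *ₚ-congˡ (a ∷ p) e = +ₚ-cong (·-cong R.refl e) (∷-cong R.refl (*ₚ-congˡ p e))

  *ₚ-zeroʳ : ∀ p → (p *ₚ 0ₚ) ≈ₚ 0ₚ
  *ₚ-zeroʳ []      = ≈ₚ.refl
  *ₚ-zeroʳ (a ∷ p) = ≈ₚ.trans (∷-cong R.refl (*ₚ-zeroʳ p)) 0∷-zero

  -- Multiplication recurses on its left factor; this is the mirror recursion on the right factor,
  -- and commutativity follows from the two together.
  *ₚ-∷ : ∀ p b q → (p *ₚ (b ∷ q)) ≈ₚ (b · p +ₚ (0# ∷ (p *ₚ q)))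
  *ₚ-∷ []      b q = ≈ₚ.sym 0∷-zero
  *ₚ-∷ (a ∷ p) b q = ∷-cong (R.+-congʳ (R.*-comm a b)) (begin
    a · q +ₚ p *ₚ (b ∷ q)                  ≈⟨ +ₚ-cong ≈ₚ.refl (*ₚ-∷ p b q) ⟩
    a · q +ₚ (b · p +ₚ (0# ∷ p *ₚ q))      ≈⟨ +ₚ-assoc (a · q) (b · p) _ ⟨
    (a · q +ₚ b · p) +ₚ (0# ∷ p *ₚ q)      ≈⟨ +ₚ-cong (+ₚ-comm (a · q) (b · p)) ≈ₚ.refl ⟩
    (b · p +ₚ a · q) +ₚ (0# ∷ p *ₚ q)      ≈⟨ +ₚ-assoc (b · p) (a · q) _ ⟩
    b · p +ₚ (a ∷ p) *ₚ q                  ∎)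

  *ₚ-comm : ∀ p q → (p *ₚ q) ≈ₚ (q *ₚ p)
  *ₚ-comm []      q = ≈ₚ.sym (*ₚ-zeroʳ q)
  *ₚ-comm (a ∷ p) q = begin
    a · q +ₚ (0# ∷ p *ₚ q)  ≈⟨ +ₚ-cong ≈ₚ.refl (∷-cong R.refl (*ₚ-comm p q)) ⟩
    a · q +ₚ (0# ∷ q *ₚ p)  ≈⟨ *ₚ-∷ q a p ⟨
    q *ₚ (a ∷ p)            ∎

  -- Equal polynomials may be lists of different lengths, so a recursion on the left factor does not
  -- compare `p` with `p′` directly. Commutativity moves each change to the right factor, where
  -- `*ₚ-congˡ` applies.
  *ₚ-cong : ∀ {p p′ q q′} → p ≈ₚ p′ → q ≈ₚ q′ → (p *ₚ q) ≈ₚ (p′ *ₚ q′)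
  *ₚ-cong {p} {p′} {q} {q′} e f = begin
    p *ₚ q    ≈⟨ *ₚ-congˡ p f ⟩
    p *ₚ q′   ≈⟨ *ₚ-comm p q′ ⟩
    q′ *ₚ p   ≈⟨ *ₚ-congˡ q′ e ⟩
    q′ *ₚ p′  ≈⟨ *ₚ-comm q′ p′ ⟩
    p′ *ₚ q′  ∎

  *ₚ-distribˡ-+ₚ : ∀ p q r → (p *ₚ (q +ₚ r)) ≈ₚ (p *ₚ q +ₚ p *ₚ r)
  *ₚ-distribˡ-+ₚ []      q r = ≈ₚ.refl
  *ₚ-distribˡ-+ₚ (a ∷ p) q r = begin
    a · (q +ₚ r) +ₚ (0# ∷ p *ₚ (q +ₚ r))
      ≈⟨ +ₚ-cong (·-distrib-+ₚ a q r) (≈ₚ.trans (∷-cong R.refl (*ₚ-distribˡ-+ₚ p q r)) (0∷-+ₚ (p *ₚ q) (p *ₚ r))) ⟩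
    (a · q +ₚ a · r) +ₚ ((0# ∷ p *ₚ q) +ₚ (0# ∷ p *ₚ r))
      ≈⟨ +ₚ-interchange (a · q) (a · r) _ _ ⟩
    (a ∷ p) *ₚ q +ₚ (a ∷ p) *ₚ r ∎

  *ₚ-distrib-+ₚ = Consequences.comm∧distrˡ⇒distr polySetoid +ₚ-cong *ₚ-comm *ₚ-distribˡ-+ₚ

  ·-*ₚ : ∀ a p q → ((a · p) *ₚ q) ≈ₚ (a · (p *ₚ q))
  ·-*ₚ a []      q = ≈ₚ.refl
  ·-*ₚ a (b ∷ p) q = begin
    (a R.* b) · q +ₚ (0# ∷ (a · p) *ₚ q)
      ≈⟨ +ₚ-cong (·-assoc a b q) (≈ₚ.trans (∷-cong R.refl (·-*ₚ a p q)) (0∷-· a (p *ₚ q))) ⟩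
    a · (b · q) +ₚ a · (0# ∷ p *ₚ q)
      ≈⟨ ·-distrib-+ₚ a (b · q) _ ⟨
    a · ((b ∷ p) *ₚ q) ∎

  *ₚ-assoc : ∀ p q r → ((p *ₚ q) *ₚ r) ≈ₚ (p *ₚ (q *ₚ r))
  *ₚ-assoc []      q r = ≈ₚ.refl
  *ₚ-assoc (a ∷ p) q r = begin
    (a · q +ₚ (0# ∷ p *ₚ q)) *ₚ r
      ≈⟨ proj₂ *ₚ-distrib-+ₚ r (a · q) _ ⟩
    -- The shifted factor `0# ∷ p *ₚ q` unfolds into `0# · r`, which vanishes, plus a shifted
    -- product.
    (a · q) *ₚ r +ₚ (0# · r +ₚ (0# ∷ (p *ₚ q) *ₚ r))
      ≈⟨ +ₚ-cong (·-*ₚ a q r) (+ₚ-cong (0·-zero r) (∷-cong R.refl (*ₚ-assoc p q r))) ⟩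
    a · (q *ₚ r) +ₚ (0# ∷ p *ₚ (q *ₚ r)) ∎

  *ₚ-identityˡ : ∀ p → (1ₚ *ₚ p) ≈ₚ p
  *ₚ-identityˡ p = begin
    1# · p +ₚ (0# ∷ [])  ≈⟨ +ₚ-cong (1·-identity p) 0∷-zero ⟩
    p +ₚ 0ₚ              ≈⟨ +ₚ-comm p 0ₚ ⟩
    p                    ∎

  commutativeRing : CommutativeRing c ℓ
  commutativeRing = record
    { Carrier = Poly ; _≈_ = _≈ₚ_ ; _+_ = _+ₚ_ ; _*_ = _*ₚ_ ; -_ = -ₚ_ ; 0# = 0ₚ ; 1# = 1ₚ
    ; isCommutativeRing = record
      { isRing = record
        { +-isAbelianGroup = record
          { isGroup = record
            { isMonoid = record
              { isSemigroup = record
                { isMagma = record { isEquivalence = ≈ₚ-isEquivalence ; ∙-cong = +ₚ-cong }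
                ; assoc = +ₚ-assoc
                }
              ; identity = comm∧idˡ⇒id +ₚ-comm +ₚ-identityˡ
              }
            ; inverse = comm∧invˡ⇒inv +ₚ-comm -ₚ-inverseˡ
            ; ⁻¹-cong = -ₚ-cong
            }
          ; comm = +ₚ-comm
          }
        ; *-cong = *ₚ-cong
        ; *-assoc = *ₚ-assoc
        ; *-identity = comm∧idˡ⇒id *ₚ-comm *ₚ-identityˡ
        ; distrib = *ₚ-distrib-+ₚ
        }
      ; *-comm = *ₚ-comm
      }
    }
    where open Consequences polySetoid using (comm∧idˡ⇒id; comm∧invˡ⇒inv)

-- Induction on binary digits, and the logarithm of odd numbers.

binary-induction : ∀ {p} (P : ℕ → Set p) → P 1 →
  (∀ m .{{_ : NonZero m}} → P m → P (2 ℕ.* m)) →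
  (∀ m .{{_ : NonZero m}} → P m → P (suc m) → P (suc (2 ℕ.* m))) →
  ∀ k .{{_ : NonZero k}} → P k
binary-induction P p₁ p-even p-odd k {{k≢0}} = <-rec Q step k k≢0
  where
  -- Well-founded induction ranges over all naturals; carrying the nonzero hypothesis in the motive
  -- makes the case 0 vacuous.
  Q : ℕ → Set _
  Q k = .(NonZero k) → P k

  step-halving : ∀ {k} → Halving k → (∀ {j} → j < k → Q j) → Q k
  step-halving (even zero)      rec ()
  step-halving (even m@(suc _)) rec _ = p-even m (rec (ℕ.m<m+n m (s≤s z≤n)) _)
  step-halving (odd zero)       rec _ = p₁
  -- Here m + 1 < 2m + 1 because m ≥ 1; this is why 1 is a base case of its own.
  step-halving (odd m@(suc _))  rec _ =
    p-odd m (rec (s≤s (ℕ.m≤m+n m _)) _) (rec (s≤s (ℕ.m<m+n m (s≤s z≤n))) _)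

  step : ∀ k → (∀ {j} → j < k → Q j) → Q k
  step k = step-halving (halve k)

-- Halving 2m + 1 gives m and lowers the logarithm by one. Both sides are at least 1, so the
-- truncated subtraction of 1 can be cancelled.
⌊log₂1+2*m⌋≡1+⌊log₂m⌋ : ∀ m .{{_ : NonZero m}} → ⌊log₂ suc (2 ℕ.* m) ⌋ ≡ suc ⌊log₂ m ⌋
⌊log₂1+2*m⌋≡1+⌊log₂m⌋ m@(suc _) = ℕ.∸-cancelʳ-≡ {o = 1} 1≤log (s≤s z≤n) (begin
  ⌊log₂ suc (2 ℕ.* m) ⌋ ℕ.∸ 1   ≡⟨ ⌊log₂⌊n/2⌋⌋≡⌊log₂n⌋∸1 (suc (2 ℕ.* m)) ⟨
  ⌊log₂ ℕ.⌊ suc (2 ℕ.* m) /2⌋ ⌋ ≡⟨ ≡.cong ⌊log₂_⌋ half ⟩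
  ⌊log₂ m ⌋                     ∎)
  where
  open ≡-Reasoning
  half : ℕ.⌊ suc (2 ℕ.* m) /2⌋ ≡ m
  -- The ceiling `⌈ x /2⌉` is by definition `⌊ suc x /2⌋`.
  half = ≡.trans (≡.cong (λ x → ℕ.⌊ suc (m ℕ.+ x) /2⌋) (ℕ.+-identityʳ m)) (≡.sym (ℕ.n≡⌈n+n/2⌉ m))
  1≤log : 1 ℕ.≤ ⌊log₂ suc (2 ℕ.* m) ⌋
  1≤log = ⌊log₂⌋-mono-≤ {2} {suc (2 ℕ.* m)} (s≤s (s≤s z≤n))

-- The identity in an arbitrary commutative ring with the required inverses.

-- τ, b i, s i and d play the roles of t, B i, S i and 2 − t; u and β i are the
-- inverses of τ and b i.  Nothing is assumed about the values at i = 0.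
record SternFamily {c ℓ} (F : CommutativeRing c ℓ) : Set (c ⊔ ℓ) where
  open CommutativeRing F
  open Exp semiring using (_^_)
  field
    τ u d  : Carrier
    b β s  : ℕ → Carrier
    τu≈1   : τ * u ≈ 1#
    d+τ≈2  : d + τ ≈ 1# + 1#
    bβ≈1   : ∀ i .{{_ : NonZero i}} → b i * β i ≈ 1#
    b-1    : b 1 ≈ 1#
    b-even : ∀ n .{{_ : NonZero n}} → b (2 ℕ.* n) ≈ τ * b n
    b-odd  : ∀ n .{{_ : NonZero n}} → b (suc (2 ℕ.* n)) ≈ b n + b (suc n)
    s-1    : s 1 ≈ 0#
    s-even : ∀ n .{{_ : NonZero n}} → s (2 ℕ.* n) ≈ τ * s n
    s-odd  : ∀ n .{{_ : NonZero n}} → s (suc (2 ℕ.* n)) ≈ s n + s (suc n) + τ ^ ⌊log₂ n ⌋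

module SternSum {c ℓ} {F : CommutativeRing c ℓ} (family : SternFamily F) where

  open SternFamily family
  open CommutativeRing F
  open Exp semiring using (_^_; ^-homo-*)
  open NaturalCoefficients commutativeSemiring
  open GroupProperties +-group using (∙-cancelʳ)
  open SetoidReasoning setoid

  inverse-unique : ∀ {x y z} → x * y ≈ 1# → x * z ≈ 1# → y ≈ z
  inverse-unique {x} {y} {z} xy≈1 xz≈1 = begin
    y            ≈⟨ *-identityʳ y ⟨
    y * 1#       ≈⟨ *-congˡ xz≈1 ⟨
    y * (x * z)  ≈⟨ solve 3 (λ x y z → y :* (x :* z) := x :* y :* z) refl x y z ⟩
    x * y * z    ≈⟨ *-congʳ xy≈1 ⟩
    1# * z       ≈⟨ *-identityˡ z ⟩
    z            ∎

  β-even : ∀ n .{{_ : NonZero n}} → β (2 ℕ.* n) ≈ u * β n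
  β-even n@(suc _) = inverse-unique (bβ≈1 (2 ℕ.* n)) (begin
    b (2 ℕ.* n) * (u * β n)    ≈⟨ *-congʳ (b-even n) ⟩
    τ * b n * (u * β n)        ≈⟨ solve 4 (λ τ b u β → τ :* b :* (u :* β) := τ :* u :* (b :* β)) refl τ (b n) u (β n) ⟩
    τ * u * (b n * β n)        ≈⟨ *-cong τu≈1 (bβ≈1 n) ⟩
    1# * 1#                    ≈⟨ *-identityˡ 1# ⟩
    1#                         ∎)

  g : ℕ → Carrier
  g i = β i * β (suc i)

  -- ββ′ = (b + b′)γββ′ = γ(β + β′) when γ is the inverse of b + b′.
  g-halve : ∀ n .{{_ : NonZero n}} → g (2 ℕ.* n) + g (suc (2 ℕ.* n)) ≈ u * g n
  g-halve n@(suc _) = begin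
    β (2 ℕ.* n) * γ + γ * β (2 ℕ.+ 2 ℕ.* n)
      ≈⟨ +-cong (*-congʳ (β-even n)) (*-congˡ (trans (reflexive (≡.cong β (≡.sym (ℕ.*-suc 2 n)))) (β-even (suc n)))) ⟩
    u * β n * γ + γ * (u * β (suc n))
      ≈⟨ +-cong (*-identityʳ _) (*-identityʳ _) ⟨
    u * β n * γ * 1# + γ * (u * β (suc n)) * 1#
      ≈⟨ +-cong (*-congˡ (bβ≈1 (suc n))) (*-congˡ (bβ≈1 n)) ⟨
    u * β n * γ * (b (suc n) * β (suc n)) + γ * (u * β (suc n)) * (b n * β n)
      ≈⟨ solve 6 (λ u β β′ γ b b′ → u :* β :* γ :* (b′ :* β′) :+ γ :* (u :* β′) :* (b :* β)
                   := u :* (β :* β′) :* ((b :+ b′) :* γ)) refl u (β n) (β (suc n)) γ (b n) (b (suc n)) ⟩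
    u * g n * ((b n + b (suc n)) * γ)
      ≈⟨ *-congˡ (trans (*-congʳ (sym (b-odd n))) (bβ≈1 (suc (2 ℕ.* n)))) ⟩
    u * g n * 1#
      ≈⟨ *-identityʳ _ ⟩
    u * g n ∎
    where γ = β (suc (2 ℕ.* n))

  -- Sums of consecutive reciprocals and their behaviour under doubling.

  ∑g : (a m : ℕ) → Carrier
  ∑g a zero    = 0#
  ∑g a (suc m) = g a + ∑g (suc a) m

  -- The recursion of `∑g` opens a range at its lower end; this opens it at the upper end, as needed
  -- to move both ends of a range.
  ∑g-snoc : ∀ a m → ∑g a (suc m) ≈ ∑g a m + g (a ℕ.+ m)
  ∑g-snoc a zero    = trans (+-comm (g a) 0#) (+-congˡ (reflexive (≡.cong g (≡.sym (ℕ.+-identityʳ a)))))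
  ∑g-snoc a (suc m) = begin
    g a + ∑g (suc a) (suc m)                      ≈⟨ +-congˡ (∑g-snoc (suc a) m) ⟩
    g a + (∑g (suc a) m + g (suc a ℕ.+ m))        ≈⟨ +-assoc _ _ _ ⟨
    g a + ∑g (suc a) m + g (suc a ℕ.+ m)          ≡⟨ ≡.cong (λ i → g a + ∑g (suc a) m + g i) (ℕ.+-suc a m) ⟨
    g a + ∑g (suc a) m + g (a ℕ.+ suc m)          ∎

  -- The 2m terms starting at 2a fall into m pairs with indices 2i and 2i + 1, and `g-halve`
  -- contracts each pair.
  ∑g-halve : ∀ a m .{{_ : NonZero a}} → ∑g (2 ℕ.* a) (2 ℕ.* m) ≈ u * ∑g a m
  ∑g-halve a zero    = sym (zeroʳ u)
  ∑g-halve a (suc m) = begin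
    ∑g (2 ℕ.* a) (2 ℕ.* suc m)
      ≡⟨ ≡.cong (∑g (2 ℕ.* a)) (ℕ.*-suc 2 m) ⟩
    g (2 ℕ.* a) + (g (suc (2 ℕ.* a)) + ∑g (2 ℕ.+ 2 ℕ.* a) (2 ℕ.* m))
      ≈⟨ +-assoc _ _ _ ⟨
    g (2 ℕ.* a) + g (suc (2 ℕ.* a)) + ∑g (2 ℕ.+ 2 ℕ.* a) (2 ℕ.* m)
      ≡⟨ ≡.cong (λ i → g (2 ℕ.* a) + g (suc (2 ℕ.* a)) + ∑g i (2 ℕ.* m)) (ℕ.*-suc 2 a) ⟨
    g (2 ℕ.* a) + g (suc (2 ℕ.* a)) + ∑g (2 ℕ.* suc a) (2 ℕ.* m)
      ≈⟨ +-cong (g-halve a) (∑g-halve (suc a) m) ⟩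
    u * g a + u * ∑g (suc a) m
      ≈⟨ distribˡ u _ _ ⟨
    u * (g a + ∑g (suc a) m) ∎

  T : ℕ → Carrier
  T a = ∑g a a

  T-even : ∀ a .{{_ : NonZero a}} → T (2 ℕ.* a) ≈ u * T a
  T-even a = ∑g-halve a a

  -- Passing from [a, 2a) to [a + 1, 2a + 2) drops a and gains 2a and 2a + 1.
  T-suc : ∀ a .{{_ : NonZero a}} → T a + u * g a ≈ g a + T (suc a)
  T-suc a = begin
    T a + u * g a
      ≈⟨ +-congˡ (g-halve a) ⟨
    T a + (g (2 ℕ.* a) + g (suc (2 ℕ.* a)))
      ≈⟨ +-assoc _ _ _ ⟨
    T a + g (2 ℕ.* a) + g (suc (2 ℕ.* a))
      ≡⟨ ≡.cong (λ i → T a + g i + g (suc i)) (≡.cong (a ℕ.+_) (ℕ.+-identityʳ a)) ⟩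
    T a + g (a ℕ.+ a) + g (suc (a ℕ.+ a))
      ≡⟨ ≡.cong (λ i → T a + g (a ℕ.+ a) + g i) (ℕ.+-suc a a) ⟨
    T a + g (a ℕ.+ a) + g (a ℕ.+ suc a)
      ≈⟨ +-congʳ (∑g-snoc a a) ⟨
    ∑g a (suc a) + g (a ℕ.+ suc a)
      ≈⟨ ∑g-snoc a (suc a) ⟨
    g a + T (suc a) ∎

  -- Add b k times T-suc (2k) to b (k + 1) times T-suc (2k + 1): the g-terms
  -- cancel, because b k · g (2k) = u γ = b (k + 1) · g (2k + 1).
  bT-odd : ∀ k .{{_ : NonZero k}} →
           b (suc (2 ℕ.* k)) * T (suc (2 ℕ.* k)) ≈ u * (b k * T k + b (suc k) * T (suc k))
  -- The summand uγ + u(uγ) is the contribution of the g-terms on either side: x·G + u(y·G′) before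
  -- `T-suc` is applied, y·G′ + u(x·G) afterwards. Adding it to both sides keeps the calculation
  -- free of subtraction.
  bT-odd k@(suc _) = ∙-cancelʳ (u * γ + u * (u * γ)) _ _ (begin
    b (suc (2 ℕ.* k)) * X + (u * γ + u * (u * γ))
      ≈⟨ +-cong (*-congʳ (b-odd k)) (+-cong (sym bg) (*-congˡ (sym bg′))) ⟩
    (x + y) * X + (x * G + u * (y * G′))
      ≈⟨ solve 6 (λ x y X G G′ u → (x :+ y) :* X :+ (x :* G :+ u :* (y :* G′))
                   := x :* (G :+ X) :+ y :* (X :+ u :* G′)) refl x y X G G′ u ⟩
    x * (G + X) + y * (X + u * G′)
      ≈⟨ +-cong (*-congˡ (sym (T-suc (2 ℕ.* k)))) (*-congˡ (T-suc (suc (2 ℕ.* k)))) ⟩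
    x * (T (2 ℕ.* k) + u * G) + y * (G′ + T (2 ℕ.+ 2 ℕ.* k))
      ≈⟨ +-cong (*-congˡ (+-congʳ (T-even k))) (*-congˡ (+-congˡ (trans (reflexive (≡.cong T (≡.sym (ℕ.*-suc 2 k)))) (T-even (suc k))))) ⟩
    x * (u * T k + u * G) + y * (G′ + u * T (suc k))
      ≈⟨ solve 7 (λ x y U V G G′ u → x :* (u :* U :+ u :* G) :+ y :* (G′ :+ u :* V)
                   := u :* (x :* U :+ y :* V) :+ (y :* G′ :+ u :* (x :* G))) refl x y (T k) (T (suc k)) G G′ u ⟩
    u * (x * T k + y * T (suc k)) + (y * G′ + u * (x * G))
      ≈⟨ +-congˡ (+-cong bg′ (*-congˡ bg)) ⟩
    u * (x * T k + y * T (suc k)) + (u * γ + u * (u * γ)) ∎)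
    where
    x = b k
    y = b (suc k)
    γ = β (suc (2 ℕ.* k))
    X = T (suc (2 ℕ.* k))
    G = g (2 ℕ.* k)
    G′ = g (suc (2 ℕ.* k))
    -- One computation serves both terms: β (2n) · γ is `G` for n = k and, up to the order of the
    -- factors, `G′` for n = k + 1.
    bβu : ∀ n .{{_ : NonZero n}} → b n * (β (2 ℕ.* n) * γ) ≈ u * γ
    bβu n = begin
      b n * (β (2 ℕ.* n) * γ)  ≈⟨ *-congˡ (*-congʳ (β-even n)) ⟩
      b n * (u * β n * γ)      ≈⟨ solve 4 (λ b u β γ → b :* (u :* β :* γ) := b :* β :* (u :* γ)) refl (b n) u (β n) γ ⟩
      b n * β n * (u * γ)      ≈⟨ *-congʳ (bβ≈1 n) ⟩
      1# * (u * γ)             ≈⟨ *-identityˡ _ ⟩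
      u * γ                    ∎
    bg : x * G ≈ u * γ
    bg = bβu k
    bg′ : y * G′ ≈ u * γ
    bg′ = trans (*-congˡ (trans (*-comm _ _) (*-congʳ (reflexive (≡.cong β (≡.sym (ℕ.*-suc 2 k))))))) (bβu (suc k))

  -- Logarithms against `s`, and the closed form of b k · T k.

  -- ⌊log₂_⌋ jumps only at powers of two, where s vanishes.
  s-log : ∀ k .{{_ : NonZero k}} → s (suc k) ≈ 0# ⊎ ⌊log₂ suc k ⌋ ≡ ⌊log₂ k ⌋
  -- For k = 2m the successor 2m + 1 has the same logarithm. For k = 2m + 1 the successor is 2(m +
  -- 1), so whichever alternative holds for m carries over.
  s-log = binary-induction _ (inj₁ s-2)
    (λ m _ → inj₂ (≡.trans (⌊log₂1+2*m⌋≡1+⌊log₂m⌋ m) (≡.sym (⌊log₂[2*b]⌋≡1+⌊log₂b⌋ m))))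
    (λ m h _ → odd-case m h)
    where
    s-2 : s 2 ≈ 0#
    s-2 = trans (s-even 1) (trans (*-congˡ s-1) (zeroʳ τ))
    odd-case : ∀ m .{{_ : NonZero m}} → s (suc m) ≈ 0# ⊎ ⌊log₂ suc m ⌋ ≡ ⌊log₂ m ⌋ →
               s (2 ℕ.+ 2 ℕ.* m) ≈ 0# ⊎ ⌊log₂ 2 ℕ.+ 2 ℕ.* m ⌋ ≡ ⌊log₂ suc (2 ℕ.* m) ⌋
    odd-case m h = ≡.subst (λ i → s i ≈ 0# ⊎ ⌊log₂ i ⌋ ≡ ⌊log₂ suc (2 ℕ.* m) ⌋) (ℕ.*-suc 2 m)
      (Sum.map (λ s≈0 → trans (s-even (suc m)) (trans (*-congˡ s≈0) (zeroʳ τ)))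
               (λ log≡ → ≡.trans (⌊log₂[2*b]⌋≡1+⌊log₂b⌋ (suc m))
                           (≡.trans (≡.cong suc log≡) (≡.sym (⌊log₂1+2*m⌋≡1+⌊log₂m⌋ m)))) h)

  -- In the odd case of the induction the hypothesis for k + 1 comes with its own logarithm, which
  -- this trades for that of k: either both sides vanish or the exponents agree.
  s*u^log : ∀ k .{{_ : NonZero k}} → s (suc k) * u ^ ⌊log₂ suc k ⌋ ≈ s (suc k) * u ^ ⌊log₂ k ⌋
  s*u^log k with s-log k
  ... | inj₁ s≈0  = trans (*-congʳ s≈0) (trans (zeroˡ _) (sym (trans (*-congʳ s≈0) (zeroˡ _))))
  ... | inj₂ log≡ = *-congˡ (reflexive (≡.cong (u ^_) log≡))

  τ^n*u^n≈1 : ∀ n → τ ^ n * u ^ n ≈ 1#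
  τ^n*u^n≈1 zero    = *-identityˡ 1#
  τ^n*u^n≈1 (suc n) = begin
    τ * τ ^ n * (u * u ^ n)    ≈⟨ solve 4 (λ τ x u y → τ :* x :* (u :* y) := τ :* u :* (x :* y)) refl τ (τ ^ n) u (u ^ n) ⟩
    τ * u * (τ ^ n * u ^ n)    ≈⟨ *-cong τu≈1 (τ^n*u^n≈1 n) ⟩
    1# * 1#                    ≈⟨ *-identityˡ 1# ⟩
    1#                         ∎

  bT-formula : ∀ k .{{_ : NonZero k}} → b k * T k ≈ d * s k * u ^ suc ⌊log₂ k ⌋ + u
  bT-formula = binary-induction _ base even-case odd-case
    where
    base : b 1 * T 1 ≈ d * s 1 * u ^ 1 + u
    base = begin
      b 1 * (β 1 * β 2 + 0#)   ≈⟨ *-congˡ (+-identityʳ _) ⟩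
      b 1 * (β 1 * β 2)        ≈⟨ *-congˡ (*-congˡ (β-even 1)) ⟩
      b 1 * (β 1 * (u * β 1))  ≈⟨ solve 3 (λ b β u → b :* (β :* (u :* β)) := b :* β :* (u :* β)) refl (b 1) (β 1) u ⟩
      -- The `1#` inserted here becomes `b 1` in the next step, so that `bβ≈1` removes the remaining
      -- `β 1`.
      b 1 * β 1 * (u * β 1)    ≈⟨ *-cong (bβ≈1 1) (*-congˡ (sym (*-identityˡ _))) ⟩
      1# * (u * (1# * β 1))    ≈⟨ *-congˡ (*-congˡ (trans (*-congʳ (sym b-1)) (bβ≈1 1))) ⟩
      1# * (u * 1#)            ≈⟨ solve 3 (λ d u v → con 1 :* (u :* con 1) := d :* con 0 :* v :+ u) refl d u (u ^ 1) ⟩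
      d * 0# * u ^ 1 + u       ≈⟨ +-congʳ (*-congʳ (*-congˡ s-1)) ⟨
      d * s 1 * u ^ 1 + u      ∎

    even-case : ∀ m .{{_ : NonZero m}} → b m * T m ≈ d * s m * u ^ suc ⌊log₂ m ⌋ + u →
                b (2 ℕ.* m) * T (2 ℕ.* m) ≈ d * s (2 ℕ.* m) * u ^ suc ⌊log₂ 2 ℕ.* m ⌋ + u
    even-case m h = begin
      b (2 ℕ.* m) * T (2 ℕ.* m)
        ≈⟨ *-cong (b-even m) (T-even m) ⟩
      τ * b m * (u * T m)
        ≈⟨ solve 4 (λ τ b u T → τ :* b :* (u :* T) := τ :* u :* (b :* T)) refl τ (b m) u (T m) ⟩
      τ * u * (b m * T m)
        ≈⟨ trans (*-congʳ τu≈1) (*-identityˡ _) ⟩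
      b m * T m
        ≈⟨ h ⟩
      -- The inserted τ·u splits: τ turns `s m` into `s (2 ℕ.* m)`, and u accounts for the logarithm
      -- growing by one.
      d * s m * v + u
        ≈⟨ +-congʳ (trans (sym (*-identityʳ _)) (*-congˡ (sym τu≈1))) ⟩
      d * s m * v * (τ * u) + u
        ≈⟨ solve 5 (λ d s v τ u → d :* s :* v :* (τ :* u) :+ u := d :* (τ :* s) :* (u :* v) :+ u) refl d (s m) v τ u ⟩
      d * (τ * s m) * (u * v) + u
        ≈⟨ +-congʳ (*-congʳ (*-congˡ (s-even m))) ⟨
      d * s (2 ℕ.* m) * (u * v) + u
        ≡⟨ ≡.cong (λ n → d * s (2 ℕ.* m) * u ^ suc n + u) (⌊log₂[2*b]⌋≡1+⌊log₂b⌋ m) ⟨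
      d * s (2 ℕ.* m) * u ^ suc ⌊log₂ 2 ℕ.* m ⌋ + u ∎
      where v = u ^ suc ⌊log₂ m ⌋

    odd-case : ∀ m .{{_ : NonZero m}} →
               b m * T m ≈ d * s m * u ^ suc ⌊log₂ m ⌋ + u →
               b (suc m) * T (suc m) ≈ d * s (suc m) * u ^ suc ⌊log₂ suc m ⌋ + u →
               b (suc (2 ℕ.* m)) * T (suc (2 ℕ.* m)) ≈
               d * s (suc (2 ℕ.* m)) * u ^ suc ⌊log₂ suc (2 ℕ.* m) ⌋ + u
    odd-case m h h′ = begin
      b (suc (2 ℕ.* m)) * T (suc (2 ℕ.* m))
        ≈⟨ bT-odd m ⟩
      u * (b m * T m + b (suc m) * T (suc m))
        ≈⟨ *-congˡ (+-cong h h′) ⟩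
      u * (d * s m * (u * v) + u + (d * s (suc m) * (u * u ^ ⌊log₂ suc m ⌋) + u))
        ≈⟨ solve 6 (λ u d s v s′ v′ → u :* (d :* s :* (u :* v) :+ u :+ (d :* s′ :* (u :* v′) :+ u))
                     := u :* u :* (d :* (s :* v :+ s′ :* v′) :+ (con 1 :+ con 1))) refl u d (s m) v (s (suc m)) (u ^ ⌊log₂ suc m ⌋) ⟩
      -- The summands u of the two hypotheses have become u·u·2. Splitting 2 as d + τ, the part d
      -- supplies the last term of `s-odd`, once 1 is written as a power of τ times `v`, and the
      -- part τ collapses to the final u.
      u * u * (d * (s m * v + s (suc m) * u ^ ⌊log₂ suc m ⌋) + (1# + 1#))
        ≈⟨ *-congˡ (+-cong (*-congˡ (+-congˡ (s*u^log m))) (sym d+τ≈2)) ⟩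
      u * u * (d * (s m * v + s (suc m) * v) + (d + τ))
        ≈⟨ solve 6 (λ u d s v s′ τ → u :* u :* (d :* (s :* v :+ s′ :* v) :+ (d :+ τ))
                     := u :* u :* d :* (s :* v :+ s′ :* v :+ con 1) :+ τ :* u :* u) refl u d (s m) v (s (suc m)) τ ⟩
      u * u * d * (s m * v + s (suc m) * v + 1#) + τ * u * u
        ≈⟨ +-cong (*-congˡ (+-congˡ (sym (τ^n*u^n≈1 ⌊log₂ m ⌋)))) (trans (*-congʳ τu≈1) (*-identityˡ u)) ⟩
      u * u * d * (s m * v + s (suc m) * v + τ ^ ⌊log₂ m ⌋ * v) + u
        ≈⟨ solve 6 (λ u d s v s′ w → u :* u :* d :* (s :* v :+ s′ :* v :+ w :* v) :+ u
                     := d :* (s :+ s′ :+ w) :* (u :* (u :* v)) :+ u) refl u d (s m) v (s (suc m)) (τ ^ ⌊log₂ m ⌋) ⟩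
      d * (s m + s (suc m) + τ ^ ⌊log₂ m ⌋) * (u * (u * v)) + u
        ≈⟨ +-congʳ (*-congʳ (*-congˡ (s-odd m))) ⟨
      d * s (suc (2 ℕ.* m)) * (u * (u * v)) + u
        ≡⟨ ≡.cong (λ n → d * s (suc (2 ℕ.* m)) * u ^ suc n + u) (⌊log₂1+2*m⌋≡1+⌊log₂m⌋ m) ⟨
      d * s (suc (2 ℕ.* m)) * u ^ suc ⌊log₂ suc (2 ℕ.* m) ⌋ + u ∎
      where v = u ^ ⌊log₂ m ⌋

  -- Scaling by powers of two, and the sum over a dyadic range.

  private
    k*2^1+n : ∀ k n → k ℕ.* 2 ℕ.^ suc n ≡ 2 ℕ.* (k ℕ.* 2 ℕ.^ n)
    k*2^1+n k n = ≡.trans (≡.sym (ℕ.*-assoc k 2 _))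
      (≡.trans (≡.cong (ℕ._* 2 ℕ.^ n) (ℕ.*-comm k 2)) (ℕ.*-assoc 2 k _))

  -- Stated for any f that gains a factor u under doubling, because it is applied both to `T` and to
  -- `β`.
  dyadic-scaling : ∀ (f : ℕ → Carrier) → (∀ n .{{_ : NonZero n}} → f (2 ℕ.* n) ≈ u * f n) →
             ∀ k n .{{_ : NonZero k}} → f (k ℕ.* 2 ℕ.^ n) ≈ u ^ n * f k
  dyadic-scaling f f-even k zero    =
    trans (reflexive (≡.cong f (ℕ.*-identityʳ k))) (sym (*-identityˡ (f k)))
  dyadic-scaling f f-even k (suc n) = begin
    f (k ℕ.* 2 ℕ.^ suc n)      ≡⟨ ≡.cong f (k*2^1+n k n) ⟩
    f (2 ℕ.* (k ℕ.* 2 ℕ.^ n))  ≈⟨ f-even _ {{k*2^n≢0 k n}} ⟩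
    u * f (k ℕ.* 2 ℕ.^ n)      ≈⟨ *-congˡ (dyadic-scaling f f-even k n) ⟩
    u * (u ^ n * f k)          ≈⟨ *-assoc u _ _ ⟨
    u ^ suc n * f k            ∎

  ∑g-dyadic : ∀ k n .{{_ : NonZero k}} →
    ∑g (k ℕ.* 2 ℕ.^ n) (suc (k ℕ.* 2 ℕ.^ suc n) ℕ.∸ k ℕ.* 2 ℕ.^ n) ≈
    d * s k * (u ^ suc (n ℕ.+ ⌊log₂ k ⌋) * β k)
      + u ^ suc n * β k * (β (suc (k ℕ.* 2 ℕ.^ suc n)) + 1#)
  ∑g-dyadic k n = begin
    ∑g a (suc (k ℕ.* 2 ℕ.^ suc n) ℕ.∸ a)
      -- The range includes both a and 2a, hence has a + 1 terms, one more than `T a`.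
      ≡⟨ ≡.cong (λ i → ∑g a (suc i ℕ.∸ a)) a+a ⟨
    ∑g a (suc (a ℕ.+ a) ℕ.∸ a)
      ≡⟨ ≡.cong (∑g a) (ℕ.m+n∸n≡m (suc a) a) ⟩
    ∑g a (suc a)
      ≈⟨ ∑g-snoc a a ⟩
    T a + g (a ℕ.+ a)
      ≡⟨ ≡.cong (λ i → T a + g i) a+a ⟩
    T a + β (k ℕ.* 2 ℕ.^ suc n) * β′
      ≈⟨ +-cong (dyadic-scaling T T-even k n) (*-congʳ (dyadic-scaling β β-even k (suc n))) ⟩
    u ^ n * T k + u ^ suc n * β k * β′
      ≈⟨ +-congʳ (*-congˡ T-k) ⟩
    u ^ n * (β k * (d * s k * (u * u ^ L) + u)) + u ^ suc n * β k * β′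
      ≈⟨ solve 7 (λ x β d s u y β′ → x :* (β :* (d :* s :* (u :* y) :+ u)) :+ u :* x :* β :* β′
                   := d :* s :* (u :* (x :* y) :* β) :+ u :* x :* β :* (β′ :+ con 1)) refl (u ^ n) (β k) d (s k) u (u ^ L) β′ ⟩
    d * s k * (u * (u ^ n * u ^ L) * β k) + u ^ suc n * β k * (β′ + 1#)
      ≈⟨ +-congʳ (*-congˡ (*-congʳ (*-congˡ (^-homo-* u n L)))) ⟨
    d * s k * (u ^ suc (n ℕ.+ L) * β k) + u ^ suc n * β k * (β′ + 1#) ∎
    where
    a = k ℕ.* 2 ℕ.^ n
    L = ⌊log₂ k ⌋
    β′ = β (suc (k ℕ.* 2 ℕ.^ suc n))
    a+a : a ℕ.+ a ≡ k ℕ.* 2 ℕ.^ suc n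
    a+a = ≡.sym (≡.trans (k*2^1+n k n) (≡.cong (a ℕ.+_) (ℕ.+-identityʳ a)))
    T-k : T k ≈ β k * (d * s k * u ^ suc L + u)
    T-k = begin
      T k                                 ≈⟨ *-identityˡ _ ⟨
      1# * T k                            ≈⟨ *-congʳ (bβ≈1 k) ⟨
      b k * β k * T k                     ≈⟨ solve 3 (λ b β T → b :* β :* T := β :* (b :* T)) refl (b k) (β k) (T k) ⟩
      β k * (b k * T k)                   ≈⟨ *-congˡ (bT-formula k) ⟩
      β k * (d * s k * u ^ suc L + u)     ∎

-- Fraction arithmetic over a commutative semiring.

-- The laws of fractions cross-multiplied: a/b = c/d reads a * d ≈ c * b.
module CrossMultiplication {c ℓ} (R : CommutativeSemiring c ℓ) where
  open CommutativeSemiring R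
  open NaturalCoefficients R
  open SetoidReasoning setoid

  -- Eliminating the middle fraction leaves its denominator d as a common factor; `*ₚ-cancelˡ`
  -- removes it later, where d is known to be nonzero.
  cross-trans : ∀ a b c d e f → a * d ≈ c * b → c * f ≈ e * d → d * (a * f) ≈ d * (e * b)
  cross-trans a b c d e f ad≈cb cf≈ed = begin
    d * (a * f)  ≈⟨ solve 3 (λ a d f → d :* (a :* f) := a :* d :* f) refl a d f ⟩
    a * d * f    ≈⟨ *-congʳ ad≈cb ⟩
    c * b * f    ≈⟨ solve 3 (λ b c f → c :* b :* f := c :* f :* b) refl b c f ⟩
    c * f * b    ≈⟨ *-congʳ cf≈ed ⟩
    e * d * b    ≈⟨ solve 3 (λ b d e → e :* d :* b := d :* (e :* b)) refl b d e ⟩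
    d * (e * b)  ∎

  cross-+-cong : ∀ a b a′ b′ c d c′ d′ → a * b′ ≈ a′ * b → c * d′ ≈ c′ * d →
                 (a * d + c * b) * (b′ * d′) ≈ (a′ * d′ + c′ * b′) * (b * d)
  cross-+-cong a b a′ b′ c d c′ d′ e f = begin
    (a * d + c * b) * (b′ * d′)
      ≈⟨ solve 6 (λ a b b′ c d d′ → (a :* d :+ c :* b) :* (b′ :* d′)
                   := a :* b′ :* (d :* d′) :+ c :* d′ :* (b :* b′)) refl a b b′ c d d′ ⟩
    a * b′ * (d * d′) + c * d′ * (b * b′)
      ≈⟨ +-cong (*-congʳ e) (*-congʳ f) ⟩
    a′ * b * (d * d′) + c′ * d * (b * b′)
      ≈⟨ solve 6 (λ a′ b b′ c′ d d′ → a′ :* b :* (d :* d′) :+ c′ :* d :* (b :* b′)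
                   := (a′ :* d′ :+ c′ :* b′) :* (b :* d)) refl a′ b b′ c′ d d′ ⟩
    (a′ * d′ + c′ * b′) * (b * d) ∎

  cross-*-cong : ∀ a b a′ b′ c d c′ d′ → a * b′ ≈ a′ * b → c * d′ ≈ c′ * d →
                 a * c * (b′ * d′) ≈ a′ * c′ * (b * d)
  cross-*-cong a b a′ b′ c d c′ d′ e f = begin
    a * c * (b′ * d′)    ≈⟨ solve 4 (λ a b′ c d′ → a :* c :* (b′ :* d′) := a :* b′ :* (c :* d′)) refl a b′ c d′ ⟩
    a * b′ * (c * d′)    ≈⟨ *-cong e f ⟩
    a′ * b * (c′ * d)    ≈⟨ solve 4 (λ a b′ c d′ → a :* b′ :* (c :* d′) := a :* c :* (b′ :* d′)) refl a′ b c′ d ⟩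
    a′ * c′ * (b * d)    ∎

  cross-+-assoc : ∀ a b c d e f →
    ((a * d + c * b) * f + e * (b * d)) * (b * (d * f)) ≈ (a * (d * f) + (c * f + e * d) * b) * (b * d * f)
  cross-+-assoc = solve 6 (λ a b c d e f →
    ((a :* d :+ c :* b) :* f :+ e :* (b :* d)) :* (b :* (d :* f)) :=
    (a :* (d :* f) :+ (c :* f :+ e :* d) :* b) :* (b :* d :* f)) refl

  cross-+-comm : ∀ a b c d → (a * d + c * b) * (d * b) ≈ (c * b + a * d) * (b * d)
  cross-+-comm = solve 4 (λ a b c d →
    (a :* d :+ c :* b) :* (d :* b) := (c :* b :+ a :* d) :* (b :* d)) refl

  cross-+-identityˡ : ∀ a b → (0# * b + a * 1#) * b ≈ a * (1# * b)
  cross-+-identityˡ = solve 2 (λ a b → (con 0 :* b :+ a :* con 1) :* b := a :* (con 1 :* b)) refl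

  -- A semiring has no negation, so the negative of `a` enters as an element `a′` with the property
  -- that defines it.
  cross-inverseˡ : ∀ a a′ b → a′ + a ≈ 0# → (a′ * b + a * b) * 1# ≈ 0# * (b * b)
  cross-inverseˡ a a′ b e = begin
    (a′ * b + a * b) * 1#  ≈⟨ solve 3 (λ a a′ b → (a′ :* b :+ a :* b) :* con 1 := (a′ :+ a) :* b) refl a a′ b ⟩
    (a′ + a) * b           ≈⟨ *-congʳ e ⟩
    0# * b                 ≈⟨ solve 1 (λ b → con 0 :* b := con 0 :* (b :* b)) refl b ⟩
    0# * (b * b)           ∎

  cross-*-assoc : ∀ a b c d e f → a * c * e * (b * (d * f)) ≈ a * (c * e) * (b * d * f)
  cross-*-assoc = solve 6 (λ a b c d e f →
    a :* c :* e :* (b :* (d :* f)) := a :* (c :* e) :* (b :* d :* f)) refl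

  cross-*-comm : ∀ a b c d → a * c * (d * b) ≈ c * a * (b * d)
  cross-*-comm = solve 4 (λ a b c d → a :* c :* (d :* b) := c :* a :* (b :* d)) refl

  cross-*-identityˡ : ∀ a b → 1# * a * b ≈ a * (1# * b)
  cross-*-identityˡ = solve 2 (λ a b → con 1 :* a :* b := a :* (con 1 :* b)) refl

  cross-distribˡ : ∀ a b c d e f →
    a * (c * f + e * d) * (b * d * (b * f)) ≈ (a * c * (b * f) + a * e * (b * d)) * (b * (d * f))
  cross-distribˡ = solve 6 (λ a b c d e f →
    a :* (c :* f :+ e :* d) :* (b :* d :* (b :* f)) :=
    (a :* c :* (b :* f) :+ a :* e :* (b :* d)) :* (b :* (d :* f))) refl

  cross-embed-+ : ∀ a b → (a + b) * (1# * 1#) ≈ (a * 1# + b * 1#) * 1#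
  cross-embed-+ = solve 2 (λ a b →
    (a :+ b) :* (con 1 :* con 1) := (a :* con 1 :+ b :* con 1) :* con 1) refl

  cross-embed-* : ∀ a b → a * b * (1# * 1#) ≈ a * b * 1#
  cross-embed-* = solve 2 (λ a b → a :* b :* (con 1 :* con 1) := a :* b :* con 1) refl

  cross-quotient : ∀ a b → a * (1# * b) ≈ a * 1# * b
  cross-quotient = solve 2 (λ a b → a :* (con 1 :* b) := a :* con 1 :* b) refl

  cross-reciprocal : ∀ a → a * 1# * 1# ≈ 1# * (1# * a)
  cross-reciprocal = solve 1 (λ a → a :* con 1 :* con 1 := con 1 :* (con 1 :* a)) refl

  cross-reciprocal-* : ∀ a b → 1# * (a * b) ≈ 1# * 1# * (a * b)
  cross-reciprocal-* = solve 2 (λ a b → con 1 :* (a :* b) := con 1 :* con 1 :* (a :* b)) refl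

-- Cancellation in ℚ[t] and the ring structure on ℚ(t).

open import Defs

ℚ[t]-commutativeRing : CommutativeRing _ _
ℚ[t]-commutativeRing = PolynomialRing.commutativeRing ℚ.+-*-commutativeRing

private
  module P = CommutativeRing ℚ[t]-commutativeRing

open CrossMultiplication P.commutativeSemiring

-- The product d(p - q) is zero and ℚ[t] has no zero divisors. That fact only refutes p - q ≠ 0, so
-- each coefficient is shown to vanish by decidability of equality in ℚ.
*ₚ-cancelˡ : ∀ d {p q} → d ℚ[t].≉0 → (d P.* p) P.≈ (d P.* q) → p P.≈ q
*ₚ-cancelˡ d {p} {q} d≉0 dp≈dq = x∙y⁻¹≈ε⇒x≈y p q (ℚ[t].coeffs λ i →
  decidable-stable (ℚ[t].coeff (p P.- q) i ℚ.≟ 0ℚ) λ ≢0 →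
    ℚ[t]-domain.*ₚ-≉0 {d} d≉0 (λ e → ≢0 (ℚ[t].coeff-≈ e i)) d[p-q]≈0)
  where
  open GroupProperties P.+-group using (x∙y⁻¹≈ε⇒x≈y; x≈y⇒x∙y⁻¹≈ε)
  d[p-q]≈0 : (d P.* (p P.- q)) P.≈ P.0#
  d[p-q]≈0 = P.trans (RingProperties.x[y-z]≈xy-xz P.ring d p q) (x≈y⇒x∙y⁻¹≈ε dp≈dq)

≃-isEquivalence : IsEquivalence _≃_
≃-isEquivalence = record
  { refl  = cross P.refl
  ; sym   = λ e → cross (P.sym (cross-≈ e))
  ; trans = λ {x} {y} {z} e f → cross (*ₚ-cancelˡ (den y) (den≉0 y)
      (cross-trans (num x) (den x) (num y) (den y) (num z) (den z) (cross-≈ e) (cross-≈ f)))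
  }

≃-setoid : Setoid _ _
≃-setoid = record { isEquivalence = ≃-isEquivalence }

-ᶠ_ : ℚ⟨t⟩ → ℚ⟨t⟩
-ᶠ frac a b b≉0 = frac (P.- a) b b≉0

ℚ⟨t⟩-commutativeRing : CommutativeRing _ _
ℚ⟨t⟩-commutativeRing = record
  { Carrier = ℚ⟨t⟩ ; _≈_ = _≃_ ; _+_ = _+ᶠ_ ; _*_ = _*ᶠ_ ; -_ = -ᶠ_ ; 0# = 0ᶠ ; 1# = 1ᶠ
  ; isCommutativeRing = record
    { isRing = record
      { +-isAbelianGroup = record
        { isGroup = record
          { isMonoid = record
            { isSemigroup = record
              { isMagma = record { isEquivalence = ≃-isEquivalence ; ∙-cong = +ᶠ-cong }
              ; assoc = λ x y z → cross (cross-+-assoc (num x) (den x) (num y) (den y) (num z) (den z))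
              }
            ; identity = comm∧idˡ⇒id +ᶠ-comm {e = 0ᶠ} +ᶠ-identityˡ
            }
          ; inverse = comm∧invˡ⇒inv {_⁻¹ = -ᶠ_} {e = 0ᶠ} +ᶠ-comm -ᶠ-inverseˡ
          ; ⁻¹-cong = λ {x} {y} e → cross (P.trans (P.sym (-‿distribˡ-* (num x) (den y)))
              (P.trans (P.-‿cong (cross-≈ e)) (-‿distribˡ-* (num y) (den x))))
          }
        ; comm = +ᶠ-comm
        }
      ; *-cong = λ {x} {x′} {y} {y′} e f → cross (cross-*-cong (num x) (den x) (num x′) (den x′)
          (num y) (den y) (num y′) (den y′) (cross-≈ e) (cross-≈ f))
      ; *-assoc = λ x y z → cross (cross-*-assoc (num x) (den x) (num y) (den y) (num z) (den z))
      ; *-identity = comm∧idˡ⇒id *ᶠ-comm {e = 1ᶠ} *ᶠ-identityˡ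
      ; distrib = comm∧distrˡ⇒distr +ᶠ-cong *ᶠ-comm λ x y z →
          cross (cross-distribˡ (num x) (den x) (num y) (den y) (num z) (den z))
      }
    ; *-comm = *ᶠ-comm
    }
  }
  where
  open Consequences ≃-setoid using (comm∧idˡ⇒id; comm∧invˡ⇒inv; comm∧distrˡ⇒distr)
  open RingProperties P.ring using (-‿distribˡ-*)
  +ᶠ-cong : ∀ {x x′ y y′} → x ≃ x′ → y ≃ y′ → (x +ᶠ y) ≃ (x′ +ᶠ y′)
  +ᶠ-cong {x} {x′} {y} {y′} e f = cross (cross-+-cong (num x) (den x) (num x′) (den x′)
    (num y) (den y) (num y′) (den y′) (cross-≈ e) (cross-≈ f))
  +ᶠ-comm : ∀ x y → (x +ᶠ y) ≃ (y +ᶠ x)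
  +ᶠ-comm x y = cross (cross-+-comm (num x) (den x) (num y) (den y))
  +ᶠ-identityˡ : ∀ x → (0ᶠ +ᶠ x) ≃ x
  +ᶠ-identityˡ x = cross (cross-+-identityˡ (num x) (den x))
  -ᶠ-inverseˡ : ∀ x → ((-ᶠ x) +ᶠ x) ≃ 0ᶠ
  -ᶠ-inverseˡ x = cross (cross-inverseˡ (num x) (P.- num x) (den x) (P.-‿inverseˡ (num x)))
  *ᶠ-comm : ∀ x y → (x *ᶠ y) ≃ (y *ᶠ x)
  *ᶠ-comm x y = cross (cross-*-comm (num x) (den x) (num y) (den y))
  *ᶠ-identityˡ : ∀ x → (1ᶠ *ᶠ x) ≃ x
  *ᶠ-identityˡ x = cross (cross-*-identityˡ (num x) (den x))

-- The embedding of ℤ[t] in ℚ(t), and reciprocals.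

/1-homo-+ : ∀ a b → (a ℤ.+ b) ℚ./ 1 ≡ a ℚ./ 1 ℚ.+ b ℚ./ 1
-- In the unnormalised rationals no gcd is divided out, so the sum of a/1 and b/1 computes directly,
-- with numerator a·1 + b·1.
/1-homo-+ a b = ℚ.toℚᵘ-injective (begin
  ℚ.toℚᵘ ((a ℤ.+ b) ℚ./ 1)                      ≈⟨ ℚ.toℚᵘ-fromℚᵘ (ℚᵘ.mkℚᵘ (a ℤ.+ b) 0) ⟩
  ℚᵘ.mkℚᵘ (a ℤ.+ b) 0                           ≡⟨ ≡.cong₂ (λ x y → ℚᵘ.mkℚᵘ (x ℤ.+ y) 0) (ℤ.*-identityʳ a) (ℤ.*-identityʳ b) ⟨
  ℚᵘ.mkℚᵘ a 0 ℚᵘ.+ ℚᵘ.mkℚᵘ b 0                  ≈⟨ ℚᵘ.+-cong (ℚ.toℚᵘ-fromℚᵘ (ℚᵘ.mkℚᵘ a 0)) (ℚ.toℚᵘ-fromℚᵘ (ℚᵘ.mkℚᵘ b 0)) ⟨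
  ℚ.toℚᵘ (a ℚ./ 1) ℚᵘ.+ ℚ.toℚᵘ (b ℚ./ 1)        ≈⟨ ℚ.toℚᵘ-homo-+ (a ℚ./ 1) (b ℚ./ 1) ⟨
  ℚ.toℚᵘ (a ℚ./ 1 ℚ.+ b ℚ./ 1)                  ∎)
  where open SetoidReasoning ℚᵘ.≃-setoid

/1-homo-* : ∀ a b → (a ℤ.* b) ℚ./ 1 ≡ a ℚ./ 1 ℚ.* (b ℚ./ 1)
/1-homo-* a b = ℚ.toℚᵘ-injective (begin
  ℚ.toℚᵘ ((a ℤ.* b) ℚ./ 1)                      ≈⟨ ℚ.toℚᵘ-fromℚᵘ (ℚᵘ.mkℚᵘ (a ℤ.* b) 0) ⟩
  ℚᵘ.mkℚᵘ a 0 ℚᵘ.* ℚᵘ.mkℚᵘ b 0                  ≈⟨ ℚᵘ.*-cong (ℚ.toℚᵘ-fromℚᵘ (ℚᵘ.mkℚᵘ a 0)) (ℚ.toℚᵘ-fromℚᵘ (ℚᵘ.mkℚᵘ b 0)) ⟨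
  ℚ.toℚᵘ (a ℚ./ 1) ℚᵘ.* ℚ.toℚᵘ (b ℚ./ 1)        ≈⟨ ℚ.toℚᵘ-homo-* (a ℚ./ 1) (b ℚ./ 1) ⟨
  ℚ.toℚᵘ (a ℚ./ 1 ℚ.* (b ℚ./ 1))                  ∎)
  where open SetoidReasoning ℚᵘ.≃-setoid

-- An equality of lists and not merely of polynomials: `ι` acts entrywise, and `_+ₚ_` makes the same
-- case distinction over both rings.
ι-homo-+ : ∀ p q → ι (p +ₚ q) ≡ ι p P.+ ι q
ι-homo-+ []      q       = ≡.refl
ι-homo-+ (a ∷ p) []      = ≡.refl
ι-homo-+ (a ∷ p) (b ∷ q) = ≡.cong₂ _∷_ (/1-homo-+ a b) (ι-homo-+ p q)

ι-homo-· : ∀ a p → ι (a · p) ≡ (a ℚ./ 1) ℚ[t].· ι p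
ι-homo-· a []      = ≡.refl
ι-homo-· a (b ∷ p) = ≡.cong₂ _∷_ (/1-homo-* a b) (ι-homo-· a p)

ι-homo-* : ∀ p q → ι (p *ₚ q) ≡ ι p P.* ι q
ι-homo-* []      q = ≡.refl
ι-homo-* (a ∷ p) q = ≡.trans (ι-homo-+ (a · q) _)
  (≡.cong₂ (λ x y → x P.+ (0ℚ ∷ y)) (ι-homo-· a q) (ι-homo-* p q))

private
  module F = CommutativeRing ℚ⟨t⟩-commutativeRing
open Exp F.semiring using () renaming (_^_ to _^ᶠ_)

⟪_⟫ : ℤ[t] → ℚ⟨t⟩
⟪ p ⟫ = p / 1ₚ ⟨ 1ₚ-≉0 ⟩

⟪⟫-homo-+ : ∀ p q → ⟪ p +ₚ q ⟫ ≃ ⟪ p ⟫ +ᶠ ⟪ q ⟫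
⟪⟫-homo-+ p q = cross (P.trans (P.*-congʳ (P.reflexive (ι-homo-+ p q))) (cross-embed-+ (ι p) (ι q)))

⟪⟫-homo-* : ∀ p q → ⟪ p *ₚ q ⟫ ≃ ⟪ p ⟫ *ᶠ ⟪ q ⟫
⟪⟫-homo-* p q = cross (P.trans (P.*-congʳ (P.reflexive (ι-homo-* p q))) (cross-embed-* (ι p) (ι q)))

⟪⟫-homo-^ : ∀ p n → ⟪ p ^ₚ n ⟫ ≃ ⟪ p ⟫ ^ᶠ n
⟪⟫-homo-^ p zero    = F.refl
⟪⟫-homo-^ p (suc n) = F.trans (⟪⟫-homo-* p (p ^ₚ n)) (F.*-congˡ {⟪ p ⟫} (⟪⟫-homo-^ p n))

quotient-≃ : ∀ p q (q≉0 : q ≉0) → p / q ⟨ q≉0 ⟩ ≃ ⟪ p ⟫ *ᶠ (1ₚ / q ⟨ q≉0 ⟩)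
quotient-≃ p q q≉0 = cross (cross-quotient (ι p) (ι q))

*-reciprocal : ∀ q (q≉0 : q ≉0) → ⟪ q ⟫ *ᶠ (1ₚ / q ⟨ q≉0 ⟩) ≃ 1ᶠ
*-reciprocal q q≉0 = cross (cross-reciprocal (ι q))

-- The nonvanishing proof of the product is an argument, so that the lemma applies to a fraction
-- whichever such proof it carries; `_≃_` compares numerators and denominators only.
reciprocal-* : ∀ p q (p≉0 : p ≉0) (q≉0 : q ≉0) (pq≉0 : (p *ₚ q) ≉0) →
               1ₚ / p *ₚ q ⟨ pq≉0 ⟩ ≃ (1ₚ / p ⟨ p≉0 ⟩) *ᶠ (1ₚ / q ⟨ q≉0 ⟩)
reciprocal-* p q p≉0 q≉0 pq≉0 = cross (P.trans (cross-reciprocal-* (ι p) (ι q))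
  (P.*-congˡ {P.1# P.* P.1#} (P.reflexive (≡.sym (ι-homo-* p q)))))

reciprocal-^ : ∀ p (p≉0 : p ≉0) n (pⁿ≉0 : (p ^ₚ n) ≉0) → 1ₚ / p ^ₚ n ⟨ pⁿ≉0 ⟩ ≃ (1ₚ / p ⟨ p≉0 ⟩) ^ᶠ n
reciprocal-^ p p≉0 zero    _     = cross P.refl
reciprocal-^ p p≉0 (suc n) pⁿ≉0 = F.trans (reciprocal-* p (p ^ₚ n) p≉0 (^ₚ-≉0 p≉0 n) pⁿ≉0)
  (F.*-congˡ {1ₚ / p ⟨ p≉0 ⟩} (reciprocal-^ p p≉0 n (^ₚ-≉0 p≉0 n)))

-- The Stern polynomials as an instance, and the theorem.

B⁻¹ : ℕ → ℚ⟨t⟩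
-- A default value: `B 0` is zero and has no reciprocal.
B⁻¹ zero    = 0ᶠ
B⁻¹ (suc i) = 1ₚ / B (suc i) ⟨ B-≉0 (suc i) ⟩

1/B≃B⁻¹ : ∀ i .{{_ : NonZero i}} → 1ₚ / B i ⟨ B-≉0 i ⟩ ≃ B⁻¹ i
1/B≃B⁻¹ (suc i) = F.refl

sternFamily : SternFamily ℚ⟨t⟩-commutativeRing
sternFamily = record
  { τ = ⟪ t ⟫
  ; u = 1ₚ / t ⟨ t-≉0 ⟩
  ; d = ⟪ const (+ 2) -ₚ t ⟫
  ; b = λ i → ⟪ B i ⟫
  ; β = B⁻¹
  ; s = λ i → ⟪ S i ⟫
  ; τu≈1   = *-reciprocal t t-≉0
  ; d+τ≈2  = F.trans (F.sym (⟪⟫-homo-+ (const (+ 2) -ₚ t) t))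
      -- The polynomials (2 - t) + t and 2 are closed terms, so their coefficients agree by
      -- computation.
      (cross (ℚ[t].coeffs λ { 0 → ≡.refl ; 1 → ≡.refl ; (suc (suc i)) → ≡.refl }))
  ; bβ≈1   = λ { (suc i) → *-reciprocal (B (suc i)) (B-≉0 (suc i)) }
  ; b-1    = F.refl
  ; b-even = λ n → F.trans (F.reflexive (≡.cong ⟪_⟫ (B-even n))) (⟪⟫-homo-* t (B n))
  ; b-odd  = λ n → F.trans (F.reflexive (≡.cong ⟪_⟫ (B-odd n))) (⟪⟫-homo-+ (B n) (B (suc n)))
  ; s-1    = F.refl
  ; s-even = λ n → F.trans (F.reflexive (≡.cong ⟪_⟫ (S-even n))) (⟪⟫-homo-* t (S n))
  ; s-odd  = λ n → F.trans (F.reflexive (≡.cong ⟪_⟫ (S-odd n)))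
      (F.trans (⟪⟫-homo-+ (S n +ₚ S (suc n)) _)
        (F.+-cong (⟪⟫-homo-+ (S n) (S (suc n))) (⟪⟫-homo-^ t ⌊log₂ n ⌋)))
  }

open SternSum sternFamily using (∑g; ∑g-dyadic)

sumFrom≃∑g : ∀ a m .{{_ : NonZero a}} →
  sumFrom a m (λ i → 1ₚ / B i *ₚ B (suc i) ⟨ *ₚ-≉0 (B-≉0 i) (B-≉0 (suc i)) ⟩) ≃ ∑g a m
sumFrom≃∑g a zero = F.refl
-- Exposing `a` as a successor lets `B⁻¹ a` unfold to the reciprocal of `B a`.
sumFrom≃∑g a@(suc _) (suc m) = F.+-cong
  (reciprocal-* (B a) (B (suc a)) (B-≉0 a) (B-≉0 (suc a)) (*ₚ-≉0 (B-≉0 a) (B-≉0 (suc a)))) (sumFrom≃∑g (suc a) m)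

reciprocal-t^*B : ∀ n k .{{_ : NonZero k}} (den≉0 : (t ^ₚ n *ₚ B k) ≉0) →
  1ₚ / t ^ₚ n *ₚ B k ⟨ den≉0 ⟩ ≃ (1ₚ / t ⟨ t-≉0 ⟩) ^ᶠ n *ᶠ B⁻¹ k
reciprocal-t^*B n k den≉0 = F.trans (reciprocal-* (t ^ₚ n) (B k) (^ₚ-≉0 t-≉0 n) (B-≉0 k) den≉0)
  (F.*-cong (reciprocal-^ t t-≉0 n (^ₚ-≉0 t-≉0 n)) (1/B≃B⁻¹ k))

open import Data.Nat.Base using (_+_; _*_; _^_)

mainTheorem15 : (k n : ℕ) .{{_ : NonZero k}} →
    ∑[ k * 2 ^ n ⋯ k * 2 ^ suc n ] {{k*2^n≢0 k n}}
    (λ i → 1ₚ / B i *ₚ B (suc i) ⟨ *ₚ-≉0 (B-≉0 i) (B-≉0 (suc i)) ⟩)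
    ≃
    (((const (+ 2) -ₚ t) *ₚ S k)
    / t ^ₚ suc (n + ⌊log₂ k ⌋) *ₚ B k
    ⟨ *ₚ-≉0 (^ₚ-≉0 t-≉0 (suc (n + ⌊log₂ k ⌋))) (B-≉0 k) ⟩)
    +ᶠ
    (1ₚ / t ^ₚ suc n *ₚ B k ⟨ *ₚ-≉0 (^ₚ-≉0 t-≉0 (suc n)) (B-≉0 k) ⟩)
    *ᶠ ((1ₚ / B (suc (k * 2 ^ suc n)) ⟨ B-≉0 (suc (k * 2 ^ suc n)) ⟩) +ᶠ 1ᶠ)
mainTheorem15 k n = begin
  _ ≈⟨ sumFrom≃∑g (k * 2 ^ n) (suc (k * 2 ^ suc n) ℕ.∸ k * 2 ^ n) {{k*2^n≢0 k n}} ⟩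
  _ ≈⟨ ∑g-dyadic k n ⟩
  -- Read from right to left: the fractions of the statement become products in which t to the power
  -- m times B k in a denominator contributes the m-th power of 1/t times `B⁻¹ k`.
  _ ≈⟨ F.+-cong
         (F.trans (quotient-≃ ((const (+ 2) -ₚ t) *ₚ S k) (t ^ₚ suc (n + ⌊log₂ k ⌋) *ₚ B k) (t^*B≉0 (n + ⌊log₂ k ⌋)))
           (F.*-cong (⟪⟫-homo-* (const (+ 2) -ₚ t) (S k))
                     (reciprocal-t^*B (suc (n + ⌊log₂ k ⌋)) k (t^*B≉0 (n + ⌊log₂ k ⌋)))))
         (F.*-congʳ {B⁻¹ (suc (k * 2 ^ suc n)) +ᶠ 1ᶠ} (reciprocal-t^*B (suc n) k (t^*B≉0 n))) ⟨
  _ ∎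
  where
  open SetoidReasoning ≃-setoid
  t^*B≉0 : ∀ m → (t ^ₚ suc m *ₚ B k) ≉0
  t^*B≉0 m = *ₚ-≉0 (^ₚ-≉0 t-≉0 (suc m)) (B-≉0 k)
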